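{- Let $\mathcal D=(d_1,\ldots,d_n)$ be a positive non-decreasing degree sequence and let $D_{\mathcal D}=|\{d_i : 1\le i\le n\}|$ be the number of distinct degrees in it. If the group list $L$ is stored in an external-memory list, then the optimized variant of the algorithm EM-HH (described in the context) run on $\mathcal D$ requires $O(\mathrm{scan}(D_{\mathcal D}))$ I/Os.
   Context: External memory model (Aggarwal–Vitter): there is an internal memory holding up to $M$ items and a disk of unbounded size; computation is only possible on items in internal memory; one I/O transfers a block of $B$ consecutive items between disk and internal memory. $\mathrm{scan}(k)=\Theta(k/B)$ is the number of I/Os for reading or writing $k$ contiguous items. An external-memory list is a linked list on disk that executes any sequence of $k$ sequential read, insertion and deletion requests to adjacent positions (i.e. without seeking) in $O(\mathrm{scan}(k))$ I/Os. A constant number of blocks of the list may be kept cached in internal memory. Only the I/Os for accessing the list $L$ are counted: the edges produced are emitted as a stream and the cost of storing this output is not counted. Task: EM-HH is a variant of the Havel–Hakimi algorithm. It takes a positive non-decreasing sequence $\mathcal D=(d_1,\ldots,d_n)$ for nodes $v_1,\ldots,v_n$ and emits the edges of a simple graph realizing it (if $\mathcal D$ is graphical; unsatisfiable requests are ignored). Data structure: a doubly linked list $L=[g_j]_{1\le j\le |L|}$ of groups $g_j=(b_j,n_j,\delta_j)$, where $g_j$ says that the $n_j$ nodes $v_{b_j},\ldots,v_{b_j+n_j-1}$ currently have remaining degree $\delta_j$. Initially there is one group per distinct degree of $\mathcal D$, so $|L|=D_{\mathcal D}$. At the beginning of every iteration these invariants hold: (I1) $\delta_j<\delta_{j+1}$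 for all $1\le j<|L|$; (I2) $b_j+n_j=b_{j+1}$ for all $1\le j<|L|$. Algorithm: EM-HH works in $n$ rounds. Each round extracts the node $u=v_{b_1}$ (smallest id, minimal remaining degree $\delta_1$) by setting $b_1\gets b_1+1$, $n_1\gets n_1-1$; if $g_1$ becomes empty it is removed from $L$ at the end of the round. Then $u$ is connected to $\delta_1$ nodes from the end of $L$. Let $g_j$ be the group of smallest index to which $u$ connects. (C1) If $u$ connects to all nodes of $g_j$, the edges from $u$ to the last $\delta_1$ nodes are emitted and the degrees of $g_j,\ldots,g_{|L|}$ are decremented by one. If then $\delta_{j-1}=\delta_j$, the two groups are merged ($n_{j-1}\gets n_{j-1}+n_j$, delete $g_j$). (C2) If $u$ connects only to $a<n_j$ nodes of $g_j$, then $g_j$ is split into adjacent groups $g_j'$ (the first $a$ nodes) and $g_j''$ (the remaining $n_j-a$ nodes). Node $u$ is connected to all nodes of $g_j'$, whose degree is decremented by one, and to all nodes of $g_{j+1},\ldots,g_{|L|}$, whose degrees are decremented by one as in (C1). Adjacent groups of equal degree that arise are merged as in (C1), restoring (I1). Optimized variant: only groups in the vicinity of $g_j$ (the active frontier) can be split or merged. The groups $g_{j+1},\ldots,g_{|L|}$ are called stable; their degrees are not explicitly decremented in every round. Instead a global iteration counter $I$ is maintained. When a group $g_k$ becomes stable in iteration $I_0$, its stored value is set to $\delta_k\gets\delta_k+I_0$; when it has to be activated again (as a merge candidate) in iteration $I>I_0$, its actual degree is recovered by $\delta_k\gets\delta_k-I$. -}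

module Defs where

open import Data.Bool using (if_then_else_)
open import Data.List using (List; []; _∷_; _++_; concatMap; foldr; length; map; upTo; deduplicate)
open import Data.Nat using (ℕ; zero; suc; pred; _+_; _∸_; _⊓_; _≤_; _≡ᵇ_; _<ᵇ_; _≟_; NonZero)
open import Data.Nat.DivMod using (_/_)
open import Data.Product using (_×_; _,_)
open import Data.Unit using (⊤; tt)
open import Relation.Binary.PropositionalEquality using (_≡_)

record Group : Set where
  constructor group
  field
    begin  : ℕ
    size   : ℕ
    degree : ℕ

open Group public

prependNode : ℕ → ℕ → List Group → List Group
prependNode i d []       = group i 1 d ∷ []
prependNode i d (g ∷ gs) =
  if d ≡ᵇ degree g then group i (suc (size g)) d ∷ gs
                   else group i 1 d ∷ g ∷ gs

groupsFrom : ℕ → List ℕ → List Group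
groupsFrom i []       = []
groupsFrom i (d ∷ ds) = prependNode i d (groupsFrom (suc i) ds)

-- Nodes are numbered from 1.
groups : List ℕ → List Group
groups = groupsFrom 1

distinctDegrees : List ℕ → ℕ
distinctDegrees 𝒟 = length (deduplicate _≟_ 𝒟)

-- ⌈ k / B ⌉
scan : (B : ℕ) .{{_ : NonZero B}} → ℕ → ℕ
scan B k = pred (k + B) / B

Edge : Set
Edge = ℕ × ℕ

-- Edges from u to the k consecutive nodes starting at b.
edgesTo : ℕ → ℕ → ℕ → List Edge
edgesTo u b k = map (λ i → (u , b + i)) (upTo k)

-- Programs issuing requests to one list of groups.  Positions count from 0
-- and refer to the list at the time of the request.
data Prog (A : Set) : Set where
  return      : A → Prog A
  read        : ℕ → (Group → Prog A) → Prog A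
  write       : ℕ → Group → Prog A → Prog A
  insertAfter : ℕ → Group → Prog A → Prog A
  delete      : ℕ → Prog A → Prog A
  emit        : List Edge → Prog A → Prog A

infixl 1 _>>=_

_>>=_ : {A C : Set} → Prog A → (A → Prog C) → Prog C
return x          >>= f = f x
read i κ          >>= f = read i (λ g → κ g >>= f)
write i g p       >>= f = write i g (p >>= f)
insertAfter i g p >>= f = insertAfter i g (p >>= f)
delete i p        >>= f = delete i (p >>= f)
emit es p         >>= f = emit es (p >>= f)

-- The O(1) counters EM-HH keeps in internal memory.  The list is cut into
-- `active` groups, holding their actual degree, followed by `stable` groups,
-- holding their actual degree plus `iteration`; the latter comprise
-- `stableNodes` nodes.  The frontier group, the first one in list order that
-- the extracted node connects to, is the last active group.
record Registers : Set where
  constructor registers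
  field
    iteration   : ℕ
    active      : ℕ
    stable      : ℕ
    stableNodes : ℕ

-- The head must carry its actual degree when it is extracted from.
activateHead : Registers → Prog Registers
activateHead (registers I zero (suc r) s) =
  read 0 λ g →
  write 0 (group (begin g) (size g) (degree g ∸ I)) (
  return (registers I 1 r (s ∸ size g)))
activateHead R = return R

-- Move the frontier towards the end until fewer than t nodes are stable.
activateUntil : ℕ → (I f r s : ℕ) → Prog Registers
activateUntil t I f zero    s = return (registers I f zero s)
activateUntil t I f (suc r) s =
  if s <ᵇ t
  then return (registers I f (suc r) s)
  else (read f λ g →
        write f (group (begin g) (size g) (degree g ∸ I)) (
        activateUntil t I (suc f) r (s ∸ size g)))

-- Move the frontier towards the head until it and the stable groups together
-- have at least t nodes.
stabiliseUntil : ℕ → (I f r s : ℕ) → Prog Registers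
stabiliseUntil t I zero    r s = return (registers I zero r s)
stabiliseUntil t I (suc f) r s =
  read f λ g →
  if s + size g <ᵇ t
  then write f (group (begin g) (size g) (degree g + I)) (
       stabiliseUntil t I f (suc r) (s + size g))
  else return (registers I (suc f) r s)

-- Merge the active group at the given position into its active predecessor.
mergeLeft : ℕ → Registers → Prog Registers
mergeLeft zero    R                   = return R
mergeLeft (suc i) (registers I f r s) =
  read i λ h →
  read (suc i) λ g →
  if degree h ≡ᵇ degree g
  then write i (group (begin h) (size h + size g) (degree h)) (
       delete (suc i) (
       return (registers I (pred f) r s)))
  else return (registers I f r s)

-- Merge the first stable group into the last active group, at position i.
mergeRight : ℕ → Registers → Prog Registers
mergeRight i (registers I f zero    s) = return (registers I f zero s)
mergeRight i (registers I f (suc r) s) =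
  read i λ g →
  read (suc i) λ h →
  if degree g ≡ᵇ degree h ∸ I
  then write i (group (begin g) (size g + size h) (degree g)) (
       delete (suc i) (
       return (registers I f r (s ∸ size h))))
  else return (registers I f (suc r) s)

-- Connect u to t nodes, the frontier being at its place.  Advancing
-- `iteration` is what decrements the stable groups.  The nodes are v_1,…,v_n,
-- so the last k of them start at v_{n+1-k}.
connectFrontier : (n u t : ℕ) → Registers → Prog Registers
connectFrontier n u t (registers I zero    r s) = return (registers I zero r s)
connectFrontier n u t (registers I (suc j) r s) =
  read j λ g →
  let a = t ∸ s in
  if a ≡ᵇ size g
  then emit (edgesTo u (suc n ∸ t) t) (
       write j (group (begin g) (size g) (pred (degree g))) (
       mergeLeft j (registers (suc I) (suc j) r s)))
  else write j (group (begin g) a (pred (degree g))) (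
       insertAfter j (group (begin g + a) (size g ∸ a) (degree g)) (
       emit (edgesTo u (begin g) a ++ edgesTo u (suc n ∸ s) s) (
       mergeRight (suc j) (registers (suc I) (suc (suc j)) r s)
         >>= mergeLeft j)))

-- With t = 0 nothing is connected, no degree changes, and `iteration`
-- therefore stands still.
connect : (n u t : ℕ) → Registers → Prog Registers
connect n u zero    R                   = return R
connect n u (suc t) (registers I f r s) =
  activateUntil (suc t) I f r s >>= λ (registers I′ f′ r′ s′) →
  stabiliseUntil (suc t) I′ f′ r′ s′ >>=
  connectFrontier n u (suc t)

removeEmptyHead : Registers → Prog Registers
removeEmptyHead (registers I f r s) =
  read 0 λ g →
  if size g ≡ᵇ 0
  then delete 0 (return (registers I (pred f) r s))
  else return (registers I f r s)

-- After u = v_b is extracted, v_{b+1},…,v_n remain; requests beyond these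
-- n ∸ b nodes are unsatisfiable and ignored.
round : ℕ → Registers → Prog Registers
round n R =
  activateHead R >>= λ R′ →
  read 0 λ g →
  write 0 (group (suc (begin g)) (pred (size g)) (degree g)) (
  connect n (begin g) (degree g ⊓ (n ∸ begin g)) R′ >>=
  removeEmptyHead)

rounds : (n k : ℕ) → Registers → Prog ⊤
rounds n zero    R = return tt
rounds n (suc k) R = round n R >>= rounds n k

-- Expects the list to hold groups 𝒟.  Initially no group is stable.
em-hh : List ℕ → Prog ⊤
em-hh 𝒟 = rounds (length 𝒟) (length 𝒟) (registers 0 (length (groups 𝒟)) 0 0)

-- An external-memory list: a chain of disk blocks of consecutive items, with
-- some stretches of items currently held in internal memory.  Cached items may
-- be regrouped into blocks when they are written back, so that k requests to
-- adjacent positions of a packed list can be served with O(scan k) I/Os.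
data Cell : Set where
  cached : Group → Cell
  onDisk : List Group → Cell

Store : Set
Store = List Cell

cellItems : Cell → List Group
cellItems (cached g)   = g ∷ []
cellItems (onDisk blk) = blk

items : Store → List Group
items = concatMap cellItems

cachedItems : Store → ℕ
cachedItems []               = 0
cachedItems (cached _ ∷ σ)   = suc (cachedItems σ)
cachedItems (onDisk _ ∷ σ)   = cachedItems σ

consPacked : ℕ → Group → Store → Store
consPacked B g (onDisk blk ∷ σ) =
  if length blk <ᵇ B then onDisk (g ∷ blk) ∷ σ
                     else onDisk (g ∷ []) ∷ onDisk blk ∷ σ
consPacked B g σ                = onDisk (g ∷ []) ∷ σ

-- The list entirely on disk, all blocks but the first holding B items.
packed : ℕ → List Group → Store
packed B = foldr (consPacked B) []

-- Run B M σ p k τ x: with block size B and an internal memory of M items, the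
-- program p started on the store σ can be executed with k I/Os, ending in the
-- store τ with result x.  As in the external memory model, which blocks to
-- transfer and when is up to the execution, but requests touch only cached
-- items; em-hh addresses only the head and neighbours of the frontier.  Every eviction of a block costs an I/O, even if it is unmodified.
-- emit is free: the cost of the output stream is not counted.
data Run (B M : ℕ) {A : Set} : Store → Prog A → ℕ → Store → A → Set where

  done : ∀ {σ x} → Run B M σ (return x) 0 σ x

  loadBlock : ∀ {p k τ x} σ₁ blk σ₂ →
    cachedItems (σ₁ ++ map cached blk ++ σ₂) ≤ M →
    Run B M (σ₁ ++ map cached blk ++ σ₂) p k τ x →
    Run B M (σ₁ ++ onDisk blk ∷ σ₂) p (suc k) τ x

  storeBlock : ∀ {p k τ x} σ₁ blk σ₂ →
    length blk ≤ B →
    Run B M (σ₁ ++ onDisk blk ∷ σ₂) p k τ x →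
    Run B M (σ₁ ++ map cached blk ++ σ₂) p (suc k) τ x

  read : ∀ {i κ k τ x} σ₁ g σ₂ →
    length (items σ₁) ≡ i →
    Run B M (σ₁ ++ cached g ∷ σ₂) (κ g) k τ x →
    Run B M (σ₁ ++ cached g ∷ σ₂) (read i κ) k τ x

  write : ∀ {i g′ p k τ x} σ₁ g σ₂ →
    length (items σ₁) ≡ i →
    Run B M (σ₁ ++ cached g′ ∷ σ₂) p k τ x →
    Run B M (σ₁ ++ cached g ∷ σ₂) (write i g′ p) k τ x

  insertAfter : ∀ {i g′ p k τ x} σ₁ g σ₂ →
    length (items σ₁) ≡ i →
    cachedItems (σ₁ ++ cached g ∷ cached g′ ∷ σ₂) ≤ M →
    Run B M (σ₁ ++ cached g ∷ cached g′ ∷ σ₂) p k τ x →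
    Run B M (σ₁ ++ cached g ∷ σ₂) (insertAfter i g′ p) k τ x

  delete : ∀ {i p k τ x} σ₁ g σ₂ →
    length (items σ₁) ≡ i →
    Run B M (σ₁ ++ σ₂) p k τ x →
    Run B M (σ₁ ++ cached g ∷ σ₂) (delete i p) k τ x

  emit : ∀ {es p k τ x} {σ} →
    Run B M σ p k τ x →
    Run B M σ (emit es p) k τ x

{-# OPTIONS --safe #-}

-- The I/Os are paid for by a potential.  Around the frontier a window of O(B)
-- groups is kept cached, together with the first O(B) groups of the list.
--
-- While the minimal degree δ₁ is at most the number of nodes beyond the head
-- group, t = δ₁ never decreases, so that in terms of nodes the frontier only
-- moves towards the head.  In terms of groups it may oscillate, but only within
-- a pair of adjacent groups whose degrees differ by one: splitting a group
-- leaves such a pair, and all later splits of the pair merge back into it.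
-- Treating the pair as one group (Trail), every further group that the frontier
-- passes pays for itself, and blocks left of the window are loaded only once.
--
-- As soon as the head group is reached, one of two invariants holds for good
-- (Settled): at most δ₁ nodes lie beyond the head group, or the second group has
-- degree δ₁ + 1 and at most δ₁ nodes lie beyond it.  Either way the frontier is
-- among the first three groups, so the rest of the list is only read once more.
module Submission where

open import Defs
open import Data.Bool using (true; false; if_then_else_)
open import Data.List
  using (List; []; _∷_; _∷ʳ_; _++_; _ʳ++_; concat; deduplicate; drop;
         filter; initLast; length; map; reverse; take; _∷ʳ′_)
open import Data.List.Properties
import Data.List.Relation.Unary.All as All
open All using (All)
open import Data.List.Relation.Unary.All.Properties using (deduplicate⁺; ∷ʳ⁻)
import Data.List.Relation.Unary.Linked as Linked
open Linked using (Linked)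
open import Data.List.Relation.Unary.Linked.Properties using (Linked⇒All)
open import Data.Nat
open import Data.Nat.DivMod using (_%_; m≡m%n+[m/n]*n; m%n<n)
open import Data.Nat.Properties
open import Data.Nat.Tactic.RingSolver using (solve)
open import Data.Product using (Σ-syntax; _×_; _,_; proj₁; proj₂)
open import Data.Unit using (⊤; tt)
open import Function using (_∘_)
open import Relation.Binary.PropositionalEquality
open import Relation.Nullary using (yes; no; contradiction)
open import Relation.Nullary.Decidable using (¬?)
-- begin is a field of Group.
open ≡-Reasoning using (step-≡-⟩; step-≡-⟨; _∎) renaming (begin_ to calc_)

-- The number n of rounds is not bounded in terms of the number of groups, so no round may be
-- charged by itself, and an oscillating frontier could write and reload the same block any number
-- of times. The active side avoids this because nothing is written back there: what a split creates
-- stays in the cached trail of at most two groups. The stable side does write blocks, and has a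
-- potential with hysteresis: B per block on disk plus twice the `excess` in the upper bound
-- `B * length Rs + B + 2 + excess` of Q. Its buffer of 2B + 4 groups can overflow only after the
-- excess has passed B, and then 2B units are released, for the store and for the later load.
-- Measuring by Q instead of the actual number of stable groups is essential, since that number
-- changes in every oscillation while Q does not. Leaving a pair raises Q by at most two, at two
-- units each; hence four units per group. With G initial groups, loading the initial blocks takes
-- at most B + G units, so that B + 5G units suffice in all, which gives the factor 6.

-- With an explicit slack c the side condition is a semiring identity.
lin : ∀ {l r a b} c → l ≤ r → r + a + c ≡ l + b → a ≤ b
lin {l} {r} {a} {b} c l≤r eq =
  +-cancelˡ-≤ l a b (≤-trans (+-monoˡ-≤ a l≤r) (≤-trans (m≤m+n (r + a) c) (≤-reflexive eq)))

-- Counting cached items and list positions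

cachedItems-++ : ∀ σ τ → cachedItems (σ ++ τ) ≡ cachedItems σ + cachedItems τ
cachedItems-++ []             τ = refl
cachedItems-++ (cached _ ∷ σ) τ = cong suc (cachedItems-++ σ τ)
cachedItems-++ (onDisk _ ∷ σ) τ = cachedItems-++ σ τ

cachedItems-ʳ++ : ∀ σ τ → cachedItems (σ ʳ++ τ) ≡ cachedItems σ + cachedItems τ
cachedItems-ʳ++ []             τ = refl
cachedItems-ʳ++ (cached g ∷ σ) τ =
  trans (cachedItems-ʳ++ σ (cached g ∷ τ)) (+-suc (cachedItems σ) (cachedItems τ))
cachedItems-ʳ++ (onDisk b ∷ σ) τ = cachedItems-ʳ++ σ (onDisk b ∷ τ)

cachedItems-cached : ∀ gs → cachedItems (map cached gs) ≡ length gs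
cachedItems-cached []       = refl
cachedItems-cached (_ ∷ gs) = cong suc (cachedItems-cached gs)

cachedItems-onDisk : ∀ bs → cachedItems (map onDisk bs) ≡ 0
cachedItems-onDisk []       = refl
cachedItems-onDisk (_ ∷ bs) = cachedItems-onDisk bs

itemCount : Store → ℕ
itemCount σ = length (items σ)

itemCount-++ : ∀ σ τ → itemCount (σ ++ τ) ≡ itemCount σ + itemCount τ
itemCount-++ []      τ = refl
itemCount-++ (c ∷ σ) τ = calc
  length (cellItems c ++ items (σ ++ τ))        ≡⟨ length-++ (cellItems c) ⟩
  length (cellItems c) + itemCount (σ ++ τ)         ≡⟨ cong (length (cellItems c) +_) (itemCount-++ σ τ) ⟩
  length (cellItems c) + (itemCount σ + itemCount τ)    ≡⟨ +-assoc (length (cellItems c)) _ _ ⟨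
  length (cellItems c) + itemCount σ + itemCount τ      ≡⟨ cong (_+ itemCount τ) (length-++ (cellItems c)) ⟨
  itemCount (c ∷ σ) + itemCount τ                       ∎

itemCount-reverse : ∀ σ → itemCount (reverse σ) ≡ itemCount σ
itemCount-reverse []      = refl
itemCount-reverse (c ∷ σ) = calc
  itemCount (reverse (c ∷ σ))             ≡⟨ cong itemCount (unfold-reverse c σ) ⟩
  itemCount (reverse σ ∷ʳ c)              ≡⟨ itemCount-++ (reverse σ) (c ∷ []) ⟩
  itemCount (reverse σ) + itemCount (c ∷ [])  ≡⟨ cong (_+ itemCount (c ∷ [])) (itemCount-reverse σ) ⟩
  itemCount σ + itemCount (c ∷ [])            ≡⟨ +-comm (itemCount σ) _ ⟩
  itemCount (c ∷ []) + itemCount σ            ≡⟨ itemCount-++ (c ∷ []) σ ⟨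
  itemCount (c ∷ σ)                       ∎

focus-split : ∀ (σ₀ L R : Store) → (σ₀ ++ reverse L) ++ R ≡ σ₀ ++ (L ʳ++ R)
focus-split σ₀ L R = trans (++-assoc σ₀ (reverse L) R) (cong (σ₀ ++_) (sym (ʳ++-defn L)))

focus-position : ∀ σ₀ L → itemCount (σ₀ ++ reverse L) ≡ itemCount σ₀ + itemCount L
focus-position σ₀ L = trans (itemCount-++ σ₀ (reverse L)) (cong (itemCount σ₀ +_) (itemCount-reverse L))

-- Operations on groups and Boolean tests

total : List Group → ℕ
total []       = 0
total (g ∷ gs) = size g + total gs

lower raise : ℕ → Group → Group
lower I g = group (begin g) (size g) (degree g ∸ I)
raise I g = group (begin g) (size g) (degree g + I)

decrement : Group → Group
decrement g = group (begin g) (size g) (pred (degree g))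

extract : Group → Group
extract g = group (suc (begin g)) (pred (size g)) (degree g)

infixl 6 _⊕_
_⊕_ : Group → Group → Group
h ⊕ g = group (begin h) (size h + size g) (degree h)

splitTaken splitRest : ℕ → Group → Group
splitTaken a g = group (begin g) a (pred (degree g))
splitRest a g  = group (begin g + a) (size g ∸ a) (degree g)

-- The frontier: `es` lists the active groups behind the head g in reverse order, so its first entry
-- is the last active group, which is g itself if there is no other.
top : Group → List Group → Group
top g []      = g
top g (e ∷ _) = e

<ᵇ-true : ∀ {m n} → m < n → (m <ᵇ n) ≡ true
<ᵇ-true {m} {n} m<n with m <ᵇ n | <⇒<ᵇ m<n
... | true | _ = refl

<ᵇ-false : ∀ {m n} → n ≤ m → (m <ᵇ n) ≡ false
<ᵇ-false {m} {n} n≤m with m <ᵇ n | <ᵇ⇒< m n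
... | true  | f = contradiction (f tt) (≤⇒≯ n≤m)
... | false | _ = refl

≡ᵇ-true : ∀ {m n} → m ≡ n → (m ≡ᵇ n) ≡ true
≡ᵇ-true {m} {n} m≡n with m ≡ᵇ n | ≡⇒≡ᵇ m n m≡n
... | true | _ = refl

≡ᵇ-false : ∀ {m n} → m ≢ n → (m ≡ᵇ n) ≡ false
≡ᵇ-false {m} {n} m≢n with m ≡ᵇ n | ≡ᵇ⇒≡ m n
... | true  | f = contradiction (f tt) m≢n
... | false | _ = refl

activateUntil-idle : ∀ {s t} I f r → s < t → activateUntil t I f r s ≡ return (registers I f r s)
activateUntil-idle         I f zero    s<t = refl
activateUntil-idle {s} {t} I f (suc r) s<t rewrite <ᵇ-true s<t = refl

total-lower : ∀ I S → total (map (lower I) S) ≡ total S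
total-lower I []      = refl
total-lower I (q ∷ S) = cong (size q +_) (total-lower I S)

suc-pred-pos : ∀ {d} → 0 < d → suc (pred d) ≡ d
suc-pred-pos {suc d} _ = refl

-- Groups of the input sequence

length-prependNode-≤ : ∀ i d gs → length (prependNode i d gs) ≤ suc (length gs)
length-prependNode-≤ i d []       = ≤-refl
length-prependNode-≤ i d (g ∷ gs) with d ≟ degree g
... | yes d≡ rewrite ≡ᵇ-true d≡  = n≤1+n _
... | no d≢  rewrite ≡ᵇ-false d≢ = ≤-refl

prependNode-head : ∀ i d gs →
  Σ[ g ∈ Group ] Σ[ gs′ ∈ List Group ] (prependNode i d gs ≡ g ∷ gs′ × degree g ≡ d)
prependNode-head i d []       = _ , _ , refl , refl
prependNode-head i d (g ∷ gs) with d ≟ degree g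
... | yes d≡ rewrite ≡ᵇ-true d≡  = _ , _ , refl , refl
... | no d≢  rewrite ≡ᵇ-false d≢ = _ , _ , refl , refl

total-prependNode : ∀ i d gs → total (prependNode i d gs) ≡ suc (total gs)
total-prependNode i d []       = refl
total-prependNode i d (g ∷ gs) with d ≟ degree g
... | yes d≡ rewrite ≡ᵇ-true d≡  = refl
... | no d≢  rewrite ≡ᵇ-false d≢ = refl

total-groupsFrom : ∀ i ds → total (groupsFrom i ds) ≡ length ds
total-groupsFrom i []       = refl
total-groupsFrom i (d ∷ ds) =
  trans (total-prependNode i d (groupsFrom (suc i) ds)) (cong suc (total-groupsFrom (suc i) ds))

-- Equal degrees are adjacent in a sorted list. If d differs from its successor, it differs from all
-- later degrees, and `deduplicate` filters nothing out behind it; if not, d merely extends the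
-- first group.
length-groupsFrom : ∀ i ds → Linked _≤_ ds → length (groupsFrom i ds) ≤ distinctDegrees ds
length-groupsFrom i []           _  = z≤n
length-groupsFrom i (d ∷ [])     _  = ≤-refl
length-groupsFrom i (d ∷ d′ ∷ ds) (d≤d′ Linked.∷ sorted) with d ≟ d′
... | no d≢d′ = ≤-trans (length-prependNode-≤ i d (groupsFrom (suc i) (d′ ∷ ds)))
      (s≤s (≤-trans (length-groupsFrom (suc i) (d′ ∷ ds) sorted)
        (≤-reflexive (cong length (sym (filter-all (¬? ∘ (d ≟_)) (deduplicate⁺ _≟_ fresh)))))))
  where
  fresh : All (λ x → d ≢ x) (d′ ∷ ds)
  fresh = All.map (λ d′≤x d≡x → d≢d′ (≤-antisym d≤d′ (≤-trans d′≤x (≤-reflexive (sym d≡x)))))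
    (Linked⇒All ≤-trans ≤-refl sorted)
... | yes refl = ≤-trans (≤-reflexive same) (≤-trans (length-groupsFrom (suc i) (d ∷ ds) sorted)
      (≤-reflexive (cong (suc ∘ length) (sym once))))
  where
  G = groupsFrom (suc i) (d ∷ ds)
  same : length (prependNode i d G) ≡ length G
  same with g , gs , eq , d≡ ← prependNode-head (suc i) d (groupsFrom (suc (suc i)) ds)
    rewrite eq | ≡ᵇ-true (sym d≡) = refl
  P? = ¬? ∘ (d ≟_)
  once : filter P? (d ∷ filter P? (deduplicate _≟_ ds)) ≡ filter P? (deduplicate _≟_ ds)
  once = trans (filter-reject P? (λ d≢d → d≢d refl)) (filter-idem P? (deduplicate _≟_ ds))

-- Amortised triples and the focus in the store

module Triples (B M : ℕ) where

  -- p runs on σ with credit w, each I/O costing B; w′ is the credit left.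
  Spec : {A : Set} → ℕ → Store → Prog A → (Store → A → ℕ → Set) → Set
  Spec {A} w σ p Post =
    Σ[ k ∈ ℕ ] Σ[ τ ∈ Store ] Σ[ x ∈ A ] Σ[ w′ ∈ ℕ ]
      (Run B M σ p k τ x × B * k + w′ ≤ w × Post τ x w′)

  Run-bind : ∀ {A C : Set} {p : Prog A} {f : A → Prog C} {σ k σ′ x k′ τ y} →
             Run B M σ p k σ′ x → Run B M σ′ (f x) k′ τ y → Run B M σ (p >>= f) (k + k′) τ y
  Run-bind done                       r′ = r′
  Run-bind (loadBlock σ₁ blk σ₂ fit r) r′ = loadBlock σ₁ blk σ₂ fit (Run-bind r r′)
  Run-bind (storeBlock σ₁ blk σ₂ fit r) r′ = storeBlock σ₁ blk σ₂ fit (Run-bind r r′)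
  Run-bind (read σ₁ g σ₂ pos r)       r′ = read σ₁ g σ₂ pos (Run-bind r r′)
  Run-bind (write σ₁ g σ₂ pos r)      r′ = write σ₁ g σ₂ pos (Run-bind r r′)
  Run-bind (insertAfter σ₁ g σ₂ pos fit r) r′ = insertAfter σ₁ g σ₂ pos fit (Run-bind r r′)
  Run-bind (delete σ₁ g σ₂ pos r)     r′ = delete σ₁ g σ₂ pos (Run-bind r r′)
  Run-bind (emit r)                   r′ = emit (Run-bind r r′)

  module _ {A : Set} {Post : Store → A → ℕ → Set} where

    return▹ : ∀ {σ x w} → Post σ x w → Spec w σ (return x) Post
    return▹ {σ} {x} {w} post = 0 , σ , x , w , done , ≤-reflexive (cong (_+ w) (*-zeroʳ B)) , post

    weaken▹ : ∀ {σ p w w′} → w ≤ w′ → Spec w σ p Post → Spec w′ σ p Post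
    weaken▹ w≤w′ (k , τ , x , v , r , cost , post) = k , τ , x , v , r , ≤-trans cost w≤w′ , post

    bind▹ : ∀ {C : Set} {Mid : Store → C → ℕ → Set} {σ p w} {f : C → Prog A} →
            Spec w σ p Mid → (∀ {σ′ x w′} → Mid σ′ x w′ → Spec w′ σ′ (f x) Post) →
            Spec w σ (p >>= f) Post
    bind▹ {w = w} (k , σ′ , x , w′ , r , cost , mid) next with next mid
    ... | k′ , τ , y , w″ , r′ , cost′ , post =
      k + k′ , τ , y , w″ , Run-bind r r′ , both , post
      where
      both : B * (k + k′) + w″ ≤ w
      both = lin 0 (+-mono-≤ cost cost′) (solve (B ∷ k ∷ k′ ∷ w ∷ w′ ∷ w″ ∷ []))

    load▹ : ∀ {w p} σ₁ blk σ₂ → cachedItems (σ₁ ++ map cached blk ++ σ₂) ≤ M →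
            Spec w (σ₁ ++ map cached blk ++ σ₂) p Post →
            Spec (B + w) (σ₁ ++ onDisk blk ∷ σ₂) p Post
    load▹ {w} σ₁ blk σ₂ fit (k , τ , x , w′ , r , cost , post) =
      suc k , τ , x , w′ , loadBlock σ₁ blk σ₂ fit r ,
      lin 0 cost (solve (B ∷ k ∷ w ∷ w′ ∷ [])) , post

    store▹ : ∀ {w p} σ₁ blk σ₂ → length blk ≤ B →
             Spec w (σ₁ ++ onDisk blk ∷ σ₂) p Post →
             Spec (B + w) (σ₁ ++ map cached blk ++ σ₂) p Post
    store▹ {w} σ₁ blk σ₂ fit (k , τ , x , w′ , r , cost , post) =
      suc k , τ , x , w′ , storeBlock σ₁ blk σ₂ fit r ,
      lin 0 cost (solve (B ∷ k ∷ w ∷ w′ ∷ [])) , post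

    lift▹ : ∀ {σ σ′ p p′ w} → (∀ {k τ x} → Run B M σ p k τ x → Run B M σ′ p′ k τ x) →
            Spec w σ p Post → Spec w σ′ p′ Post
    lift▹ f (k , τ , x , w′ , r , cost , post) = k , τ , x , w′ , f r , cost , post

    emit▹ : ∀ {σ es p w} → Spec w σ p Post → Spec w σ (emit es p) Post
    emit▹ = lift▹ emit

    -- The cells left of the focus are σ₀ followed by L in reverse order, so that
    -- moving the focus across the cells of L is a definitional equality.
    module _ (σ₀ L : Store) where

      private
        at : ∀ {i} → i ≡ itemCount σ₀ + itemCount L → itemCount (σ₀ ++ reverse L) ≡ i
        at eq = trans (focus-position σ₀ L) (sym eq)

        to : ∀ {p : Prog A} {R k τ x} →
             Run B M (σ₀ ++ (L ʳ++ R)) p k τ x → Run B M ((σ₀ ++ reverse L) ++ R) p k τ x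
        to {R = R} = subst (λ σ → Run B M σ _ _ _ _) (sym (focus-split σ₀ L R))

        from : ∀ {p : Prog A} {R k τ x} →
               Run B M ((σ₀ ++ reverse L) ++ R) p k τ x → Run B M (σ₀ ++ (L ʳ++ R)) p k τ x
        from {R = R} = subst (λ σ → Run B M σ _ _ _ _) (focus-split σ₀ L R)

      read▹ : ∀ {g R i κ w} → i ≡ itemCount σ₀ + itemCount L →
              Spec w (σ₀ ++ (L ʳ++ (cached g ∷ R))) (κ g) Post →
              Spec w (σ₀ ++ (L ʳ++ (cached g ∷ R))) (read i κ) Post
      read▹ pos = lift▹ (λ r → from (read (σ₀ ++ reverse L) _ _ (at pos) (to r)))

      write▹ : ∀ {g g′ R i p w} → i ≡ itemCount σ₀ + itemCount L →
               Spec w (σ₀ ++ (L ʳ++ (cached g′ ∷ R))) p Post →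
               Spec w (σ₀ ++ (L ʳ++ (cached g ∷ R))) (write i g′ p) Post
      write▹ pos = lift▹ (λ r → from (write (σ₀ ++ reverse L) _ _ (at pos) (to r)))

      delete▹ : ∀ {g R i p w} → i ≡ itemCount σ₀ + itemCount L →
                Spec w (σ₀ ++ (L ʳ++ R)) p Post →
                Spec w (σ₀ ++ (L ʳ++ (cached g ∷ R))) (delete i p) Post
      delete▹ pos = lift▹ (λ r → from (delete (σ₀ ++ reverse L) _ _ (at pos) (to r)))

      insertAfter▹ : ∀ {g g′ R i p w} → i ≡ itemCount σ₀ + itemCount L →
                     2 + (cachedItems σ₀ + (cachedItems L + cachedItems R)) ≤ M →
                     Spec w (σ₀ ++ (L ʳ++ (cached g ∷ cached g′ ∷ R))) p Post →
                     Spec w (σ₀ ++ (L ʳ++ (cached g ∷ R))) (insertAfter i g′ p) Post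
      insertAfter▹ {g} {g′} {R} pos fit =
        lift▹ (λ r → from (insertAfter (σ₀ ++ reverse L) _ _ (at pos) fit′ (to r)))
        where
        fit′ : cachedItems ((σ₀ ++ reverse L) ++ cached g ∷ cached g′ ∷ R) ≤ M
        fit′ = ≤-trans (≤-reflexive (calc
          cachedItems ((σ₀ ++ reverse L) ++ cached g ∷ cached g′ ∷ R)
            ≡⟨ cong cachedItems (focus-split σ₀ L _) ⟩
          cachedItems (σ₀ ++ (L ʳ++ (cached g ∷ cached g′ ∷ R)))
            ≡⟨ cachedItems-++ σ₀ _ ⟩
          cachedItems σ₀ + cachedItems (L ʳ++ (cached g ∷ cached g′ ∷ R))
            ≡⟨ cong (cachedItems σ₀ +_) (cachedItems-ʳ++ L _) ⟩
          cachedItems σ₀ + (cachedItems L + (2 + cachedItems R))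
            ≡⟨ shuffle (cachedItems σ₀) (cachedItems L) (cachedItems R) ⟩
          2 + (cachedItems σ₀ + (cachedItems L + cachedItems R)) ∎)) fit
          where
          shuffle : ∀ a b c → a + (b + (2 + c)) ≡ 2 + (a + (b + c))
          shuffle a b c = solve (a ∷ b ∷ c ∷ [])

      loadAt▹ : ∀ {R p w} blk →
                cachedItems σ₀ + (cachedItems L + (length blk + cachedItems R)) ≤ M →
                Spec w (σ₀ ++ (L ʳ++ (map cached blk ++ R))) p Post →
                Spec (B + w) (σ₀ ++ (L ʳ++ (onDisk blk ∷ R))) p Post
      loadAt▹ {R} {p} {w} blk fit s =
        subst (λ σ → Spec (B + w) σ p Post) (focus-split σ₀ L _)
          (load▹ (σ₀ ++ reverse L) blk R fit′
            (subst (λ σ → Spec w σ p Post) (sym (focus-split σ₀ L _)) s))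
        where
        fit′ : cachedItems ((σ₀ ++ reverse L) ++ map cached blk ++ R) ≤ M
        fit′ = ≤-trans (≤-reflexive (calc
          cachedItems ((σ₀ ++ reverse L) ++ map cached blk ++ R)
            ≡⟨ cong cachedItems (focus-split σ₀ L _) ⟩
          cachedItems (σ₀ ++ (L ʳ++ (map cached blk ++ R)))
            ≡⟨ cachedItems-++ σ₀ _ ⟩
          cachedItems σ₀ + cachedItems (L ʳ++ (map cached blk ++ R))
            ≡⟨ cong (cachedItems σ₀ +_) (cachedItems-ʳ++ L _) ⟩
          cachedItems σ₀ + (cachedItems L + cachedItems (map cached blk ++ R))
            ≡⟨ cong (λ m → cachedItems σ₀ + (cachedItems L + m)) (cachedItems-++ (map cached blk) R) ⟩
          cachedItems σ₀ + (cachedItems L + (cachedItems (map cached blk) + cachedItems R))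
            ≡⟨ cong (λ m → cachedItems σ₀ + (cachedItems L + (m + cachedItems R))) (cachedItems-cached blk) ⟩
          cachedItems σ₀ + (cachedItems L + (length blk + cachedItems R)) ∎)) fit

      storeAt▹ : ∀ {R p w} blk → length blk ≤ B →
                 Spec w (σ₀ ++ (L ʳ++ (onDisk blk ∷ R))) p Post →
                 Spec (B + w) (σ₀ ++ (L ʳ++ (map cached blk ++ R))) p Post
      storeAt▹ {R} {p} {w} blk fit s =
        subst (λ σ → Spec (B + w) σ p Post) (focus-split σ₀ L _)
          (store▹ (σ₀ ++ reverse L) blk R fit
            (subst (λ σ → Spec w σ p Post) (sym (focus-split σ₀ L _)) s))

-- Buffers for the active groups

module EM-HH (B M n : ℕ) (0<B : 0 < B) (roomy : 8 + (B + B + (B + B + 4)) ≤ M) where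
  open Triples B M

  ʳBlock : List Group → Cell
  ʳBlock blk = onDisk (reverse blk)

  -- The active groups xs, in reverse order: W adjoins the frontier window, H is
  -- next to the head.  Blocks are only ever taken from Ls, each at cost B.
  record Left (L : Store) (xs : List Group) (v : ℕ) : Set where
    constructor left
    field
      W H   : List Group
      Ls    : List (List Group)
      L≡    : L ≡ map cached W ++ map ʳBlock Ls ++ map cached H
      xs≡   : xs ≡ W ++ concat Ls ++ H
      W≤B   : length W ≤ B
      H≤B   : length H ≤ B
      sizes : All (λ blk → 0 < length blk × length blk ≤ B) Ls
      v≡    : v ≡ B * length Ls

  cachedItems-ʳBlocks : ∀ Ls → cachedItems (map ʳBlock Ls) ≡ 0
  cachedItems-ʳBlocks []       = refl
  cachedItems-ʳBlocks (_ ∷ Ls) = cachedItems-ʳBlocks Ls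

  cachedItems-left : ∀ W Ls H →
    cachedItems (map cached W ++ map ʳBlock Ls ++ map cached H) ≡ length W + length H
  cachedItems-left W Ls H = calc
    cachedItems (map cached W ++ map ʳBlock Ls ++ map cached H)
      ≡⟨ cachedItems-++ (map cached W) _ ⟩
    cachedItems (map cached W) + cachedItems (map ʳBlock Ls ++ map cached H)
      ≡⟨ cong₂ _+_ (cachedItems-cached W) (cachedItems-++ (map ʳBlock Ls) _) ⟩
    length W + (cachedItems (map ʳBlock Ls) + cachedItems (map cached H))
      ≡⟨ cong (length W +_) (cong₂ _+_ (cachedItems-ʳBlocks Ls) (cachedItems-cached H)) ⟩
    length W + length H ∎

  Left-cached : ∀ {L xs v} → Left L xs v → cachedItems L ≤ B + B
  Left-cached (left W H Ls refl _ W≤B H≤B _ _) =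
    ≤-trans (≤-reflexive (cachedItems-left W Ls H)) (+-mono-≤ W≤B H≤B)

  itemCount-cached : ∀ gs → itemCount (map cached gs) ≡ length gs
  itemCount-cached []       = refl
  itemCount-cached (_ ∷ gs) = cong suc (itemCount-cached gs)

  itemCount-ʳBlocks : ∀ Ls → itemCount (map ʳBlock Ls) ≡ length (concat Ls)
  itemCount-ʳBlocks []         = refl
  itemCount-ʳBlocks (blk ∷ Ls) = calc
    length (reverse blk ++ items (map ʳBlock Ls))  ≡⟨ length-++ (reverse blk) ⟩
    length (reverse blk) + itemCount (map ʳBlock Ls)   ≡⟨ cong₂ _+_ (length-reverse blk) (itemCount-ʳBlocks Ls) ⟩
    length blk + length (concat Ls)                ≡⟨ length-++ blk ⟨
    length (blk ++ concat Ls)                      ∎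

  Left-itemCount : ∀ {L xs v} → Left L xs v → itemCount L ≡ length xs
  Left-itemCount (left W H Ls refl refl _ _ _ _) = calc
    itemCount (map cached W ++ map ʳBlock Ls ++ map cached H)
      ≡⟨ itemCount-++ (map cached W) _ ⟩
    itemCount (map cached W) + itemCount (map ʳBlock Ls ++ map cached H)
      ≡⟨ cong₂ _+_ (itemCount-cached W) (itemCount-++ (map ʳBlock Ls) _) ⟩
    length W + (itemCount (map ʳBlock Ls) + itemCount (map cached H))
      ≡⟨ cong (length W +_) (cong₂ _+_ (itemCount-ʳBlocks Ls) (itemCount-cached H)) ⟩
    length W + (length (concat Ls) + length H)
      ≡⟨ cong (length W +_) (length-++ (concat Ls)) ⟨
    length W + length (concat Ls ++ H)
      ≡⟨ length-++ W ⟨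
    length (W ++ concat Ls ++ H) ∎

  Left-empty : Left [] [] 0
  Left-empty = left [] [] [] refl refl z≤n z≤n All.[] (sym (*-zeroʳ B))

  Left-[] : ∀ {L v} → Left L [] v → L ≡ []
  Left-[] (left [] [] [] L≡ _ _ _ _ _) = L≡
  Left-[] (left [] _ ([] ∷ _) _ _ _ _ ((() , _) All.∷ _) _)
  Left-[] (left [] _ ((_ ∷ _) ∷ _) _ () _ _ _ _)
  Left-[] (left (_ ∷ _) _ _ _ () _ _ _ _)

  map-cached-ʳ++ : ∀ blk R → map cached blk ʳ++ R ≡ map cached (reverse blk) ++ R
  map-cached-ʳ++ blk R =
    trans (ʳ++-defn (map cached blk)) (cong (_++ R) (sym (reverse-map cached blk)))

  length-∷ʳ : ∀ {C : Set} (y : C) ys → length (ys ∷ʳ y) ≡ suc (length ys)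
  length-∷ʳ y ys = trans (length-++ ys) (+-comm (length ys) 1)

  ∷ʳ-nonempty : ∀ {C : Set} (ys : List C) {y} → [] ≢ ys ∷ʳ y
  ∷ʳ-nonempty []      ()
  ∷ʳ-nonempty (_ ∷ _) ()

  module _ {A : Set} {Post : Store → A → ℕ → Set} where

    loadLeft▹ : ∀ {p w} σ₀ L₁ blk L₂ R →
      cachedItems σ₀ + (cachedItems L₂ + (length blk + (cachedItems L₁ + cachedItems R))) ≤ M →
      Spec w (σ₀ ++ ((L₁ ++ map cached blk ++ L₂) ʳ++ R)) p Post →
      Spec (B + w) (σ₀ ++ ((L₁ ++ ʳBlock blk ∷ L₂) ʳ++ R)) p Post
    loadLeft▹ {p} {w} σ₀ L₁ blk L₂ R fit s =
      subst (λ σ → Spec (B + w) (σ₀ ++ σ) p Post) (sym (++-ʳ++ L₁))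
        (loadAt▹ σ₀ L₂ (reverse blk) fit′
          (subst (λ σ → Spec w (σ₀ ++ σ) p Post) (calc
            (L₁ ++ map cached blk ++ L₂) ʳ++ R            ≡⟨ ++-ʳ++ L₁ ⟩
            (map cached blk ++ L₂) ʳ++ (L₁ ʳ++ R)         ≡⟨ ++-ʳ++ (map cached blk) ⟩
            L₂ ʳ++ (map cached blk ʳ++ (L₁ ʳ++ R))        ≡⟨ cong (L₂ ʳ++_) (map-cached-ʳ++ blk _) ⟩
            L₂ ʳ++ (map cached (reverse blk) ++ (L₁ ʳ++ R)) ∎) s))
      where
      fit′ : cachedItems σ₀ + (cachedItems L₂ + (length (reverse blk) + cachedItems (L₁ ʳ++ R))) ≤ M
      fit′ = ≤-trans (≤-reflexive (cong₂ (λ a b → cachedItems σ₀ + (cachedItems L₂ + (a + b)))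
        (length-reverse blk) (cachedItems-ʳ++ L₁ R))) fit

    -- A block is loaded only into an empty window, so both buffers stay within B groups. The
    -- continuation gets g both removed from the left part and still in it, because a merge
    -- candidate is put back if the degrees turn out to differ.
    exposeFront▹ : ∀ {L g xs v p u} σ₀ R → Left L (g ∷ xs) v →
      cachedItems σ₀ + (B + B + cachedItems R) ≤ M →
      (∀ {L′ v′} → Left L′ xs v′ → Left (cached g ∷ L′) (g ∷ xs) v′ →
        Spec (v′ + u) (σ₀ ++ ((cached g ∷ L′) ʳ++ R)) p Post) →
      Spec (v + u) (σ₀ ++ (L ʳ++ R)) p Post
    exposeFront▹ σ₀ R (left (w ∷ W) H Ls refl refl W≤B H≤B sizes v≡) fit s =
      s (left W H Ls refl refl (≤-trans (n≤1+n _) W≤B) H≤B sizes v≡)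
        (left (w ∷ W) H Ls refl refl W≤B H≤B sizes v≡)
    -- No block separates the two buffers any more, so the one at the head becomes the window of the
    -- frontier.
    exposeFront▹ σ₀ R (left [] (h ∷ H) [] refl refl W≤B H≤B sizes v≡) fit s =
      s (left H [] [] eq′ eq (≤-trans (n≤1+n _) H≤B) z≤n sizes v≡)
        (left (h ∷ H) [] [] (cong (cached h ∷_) eq′) (cong (h ∷_) eq) H≤B z≤n sizes v≡)
      where
      eq : ∀ {C : Set} {ys : List C} → ys ≡ ys ++ []
      eq = sym (++-identityʳ _)
      eq′ : map cached H ≡ map cached H ++ []
      eq′ = eq
    exposeFront▹ σ₀ R (left [] H ([] ∷ Ls) _ _ _ _ ((() , _) All.∷ _) _) fit s
    exposeFront▹ {p = p} {u} σ₀ R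
      (left [] H ((b ∷ blk) ∷ Ls) refl refl W≤B H≤B ((_ , blk≤B) All.∷ sizes) refl) fit s =
      weaken▹ (≤-reflexive (trans (sym (+-assoc B _ u)) (cong (_+ u) (sym (*-suc B (length Ls))))))
        (loadLeft▹ σ₀ [] (b ∷ blk) (map ʳBlock Ls ++ map cached H) R fit′
          (s (left blk H Ls refl (++-assoc blk _ H) (≤-trans (n≤1+n _) blk≤B) H≤B sizes refl)
             (left (b ∷ blk) H Ls refl (++-assoc (b ∷ blk) _ H) blk≤B H≤B sizes refl)))
      where
      fit′ : cachedItems σ₀ + (cachedItems (map ʳBlock Ls ++ map cached H)
               + (length (b ∷ blk) + (0 + cachedItems R))) ≤ M
      fit′ = ≤-trans (+-monoʳ-≤ (cachedItems σ₀)
        (≤-trans (+-mono-≤ (≤-trans (≤-reflexive (cachedItems-left [] Ls H)) H≤B)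
                           (+-monoˡ-≤ (cachedItems R) blk≤B))
                 (≤-reflexive (sym (+-assoc B B _))))) fit

    exposeCachedBack▹ : ∀ {L g xs v p u} R (l : Left L (xs ∷ʳ g) v) → 0 < length (Left.H l) →
      (∀ {L′ v′} → Left L′ xs v′ → Spec (v′ + u) (cached g ∷ (L′ ʳ++ R)) p Post) →
      Spec (v + u) (L ʳ++ R) p Post
    exposeCachedBack▹ {xs = xs} {v} {p} {u} R (left W H Ls refl xs≡ W≤B H≤B sizes v≡) 0<H s
      with initLast H
    ... | H′ ∷ʳ′ h with refl , refl ← ∷ʳ-injective xs _
                     (trans xs≡ (trans (cong (W ++_) (sym (++-assoc (concat Ls) H′ _))) (sym (++-assoc W _ _)))) =
      subst (λ σ → Spec (v + u) σ p Post) (sym eq)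
        (s (left W H′ Ls refl refl W≤B
              (≤-trans (n≤1+n _) (≤-trans (≤-reflexive (sym (length-∷ʳ h H′))) H≤B)) sizes v≡))
      where
      X = map cached W
      Y = map ʳBlock Ls
      eq : (X ++ Y ++ map cached (H′ ∷ʳ h)) ʳ++ R ≡ cached h ∷ ((X ++ Y ++ map cached H′) ʳ++ R)
      eq = calc
        (X ++ Y ++ map cached (H′ ∷ʳ h)) ʳ++ R
          ≡⟨ cong (λ Z → (X ++ Y ++ Z) ʳ++ R) (map-++ cached H′ (h ∷ [])) ⟩
        (X ++ Y ++ (map cached H′ ∷ʳ cached h)) ʳ++ R
          ≡⟨ cong (λ Z → (X ++ Z) ʳ++ R) (++-assoc Y _ _) ⟨
        (X ++ ((Y ++ map cached H′) ∷ʳ cached h)) ʳ++ R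
          ≡⟨ cong (_ʳ++ R) (++-assoc X _ _) ⟨
        ((X ++ Y ++ map cached H′) ∷ʳ cached h) ʳ++ R
          ≡⟨ ++-ʳ++ (X ++ Y ++ map cached H′) ⟩
        cached h ∷ ((X ++ Y ++ map cached H′) ʳ++ R) ∎

    -- An exhausted head is replaced from this end. Both ends draw on the same blocks, so v still
    -- counts one load for each of them.
    exposeBack▹ : ∀ {L g xs v p u} R → Left L (xs ∷ʳ g) v →
      B + B + cachedItems R ≤ M →
      (∀ {L′ v′} → Left L′ xs v′ → Spec (v′ + u) (cached g ∷ (L′ ʳ++ R)) p Post) →
      Spec (v + u) (L ʳ++ R) p Post
    exposeBack▹ R l@(left W (_ ∷ _) Ls _ _ _ _ _ _) fit s = exposeCachedBack▹ R l (s≤s z≤n) s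
    exposeBack▹ {xs = xs} {v} {p} {u} R (left W [] Ls refl xs≡ W≤B H≤B sizes v≡) fit s with initLast Ls
    ... | [] with W
    ...   | [] = contradiction (sym xs≡) (∷ʳ-nonempty xs)
    -- Only the window of the frontier is left; it is reinterpreted as the buffer at the head.
    ...   | w ∷ W′ =
      exposeCachedBack▹ R
        (left [] (w ∷ W′) [] (++-identityʳ _) (trans xs≡ (++-identityʳ _)) z≤n W≤B All.[] v≡)
        (s≤s z≤n) s
    exposeBack▹ {xs = xs} {v} {p} {u} R (left W [] .(Ls′ ∷ʳ blk) refl xs≡ W≤B H≤B sizes refl) fit s
        | Ls′ ∷ʳ′ blk =
      weaken▹ (≤-reflexive cost)
        (subst (λ L → Spec _ (L ʳ++ R) p Post) (sym L≡)
          (loadLeft▹ [] (X ++ Y) blk [] R fit′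
            (exposeCachedBack▹ R
              (left W blk Ls′ (trans (cong ((X ++ Y) ++_) (++-identityʳ _)) (++-assoc X Y _))
                (trans xs≡ (cong (W ++_) concat≡)) W≤B (proj₂ (proj₂ parts)) (proj₁ parts) refl)
              (proj₁ (proj₂ parts)) s)))
      where
      X = map cached W
      Y = map ʳBlock Ls′
      parts = ∷ʳ⁻ sizes
      cost : B + (B * length Ls′ + u) ≡ B * length (Ls′ ∷ʳ blk) + u
      cost = trans (sym (+-assoc B _ u))
        (cong (_+ u) (trans (sym (*-suc B (length Ls′))) (cong (B *_) (sym (length-∷ʳ blk Ls′)))))
      concat≡ : concat (Ls′ ∷ʳ blk) ++ [] ≡ concat Ls′ ++ blk
      concat≡ = trans (++-identityʳ _)
        (trans (sym (concat-++ Ls′ (blk ∷ []))) (cong (concat Ls′ ++_) (++-identityʳ blk)))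
      L≡ : X ++ map ʳBlock (Ls′ ∷ʳ blk) ++ [] ≡ (X ++ Y) ++ ʳBlock blk ∷ []
      L≡ = trans (cong (X ++_) (trans (++-identityʳ _) (map-++ ʳBlock Ls′ (blk ∷ [])))) (sym (++-assoc X Y _))
      fit′ : 0 + (0 + (length blk + (cachedItems (X ++ Y) + cachedItems R))) ≤ M
      fit′ = ≤-trans (≤-trans (+-mono-≤ (proj₂ (proj₂ parts))
          (+-monoˡ-≤ (cachedItems R) (≤-trans (≤-reflexive XY) W≤B))) (≤-reflexive (sym (+-assoc B B _)))) fit
        where
        XY : cachedItems (X ++ Y) ≡ length W
        XY = trans (cachedItems-++ X Y)
          (trans (cong₂ _+_ (cachedItems-cached W) (cachedItems-ʳBlocks Ls′)) (+-identityʳ _))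

  -- Buffers for the stable groups

  -- The stable groups.  Q is their number up to a bounded error, chosen such that
  -- it does not oscillate; a store costs B and prepays B for loading the block
  -- again, which is covered by the excess of Q over the blocks already stored.
  record Right (R : Store) (S : List Group) (Q z : ℕ) : Set where
    constructor right
    field
      wr     : List Group
      Rs     : List (List Group)
      excess : ℕ
      R≡     : R ≡ map cached wr ++ map onDisk Rs
      S≡     : S ≡ wr ++ concat Rs
      wr≤    : length wr ≤ B + B + 4
      sizes  : All (λ blk → length blk ≡ B) Rs
      Q≤     : Q ≤ B * length Rs + B + 2 + excess
      z≡     : z ≡ B * length Rs + (excess + excess)

  length-concat : ∀ {Rs : List (List Group)} → All (λ blk → length blk ≡ B) Rs →
                  length (concat Rs) ≡ B * length Rs
  length-concat All.[] = sym (*-zeroʳ B)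
  length-concat {blk ∷ Rs} (b≡ All.∷ bs) =
    trans (length-++ blk) (trans (cong₂ _+_ b≡ (length-concat bs)) (sym (*-suc B (length Rs))))

  Right-cached : ∀ {R S Q z} → Right R S Q z → cachedItems R ≤ B + B + 4
  Right-cached (right wr Rs _ refl _ wr≤ _ _ _) = ≤-trans (≤-reflexive (trans (cachedItems-++ (map cached wr) _)
    (trans (cong₂ _+_ (cachedItems-cached wr) (cachedItems-onDisk Rs)) (+-identityʳ _)))) wr≤

  -- Each unit of growth of Q costs two: B units of excess have to cover a store as well as the load
  -- that undoes it.
  Right-raise : ∀ {R S Q Q′ z} d → Q′ ≤ Q + d → Right R S Q z → Right R S Q′ (z + (d + d))
  Right-raise {Q′ = Q′} {z} d Q′≤ (right wr Rs E R≡ S≡ wr≤ sizes Q≤ z≡) =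
    right wr Rs (E + d) R≡ S≡ wr≤ sizes
      (≤-trans Q′≤ (≤-trans (+-monoˡ-≤ d Q≤) (≤-reflexive (+-assoc _ E d))))
      (trans (cong (_+ (d + d)) z≡) (shuffle (B * length Rs) E d))
    where
    shuffle : ∀ a e d → a + (e + e) + (d + d) ≡ a + (e + d + (e + d))
    shuffle a e d = solve (a ∷ e ∷ d ∷ [])

  Right-lower : ∀ {R S Q Q′ z} → Q′ ≤ Q → Right R S Q z → Right R S Q′ z
  Right-lower Q′≤ (right wr Rs E R≡ S≡ wr≤ sizes Q≤ z≡) =
    right wr Rs E R≡ S≡ wr≤ sizes (≤-trans Q′≤ Q≤) z≡

  module _ {A : Set} {Post : Store → A → ℕ → Set} where

    -- A load happens with an empty window, when the stable groups fill exactly 1 + ρ blocks. The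
    -- slack then gives `Q ≤ B * ρ + B + 2`, so the bound survives the loss of a block with the
    -- excess unchanged, and the B units freed pay for the load.
    exposeRight▹ : ∀ {R q S Q z p u} σ₀ L → Right R (q ∷ S) Q z →
      Q ≤ 3 + length S →
      cachedItems σ₀ + (cachedItems L + B) ≤ M →
      (∀ {R′ z′} → Right R′ S Q z′ → Right (cached q ∷ R′) (q ∷ S) Q z′ →
        Spec (z′ + u) (σ₀ ++ (L ʳ++ (cached q ∷ R′))) p Post) →
      Spec (z + u) (σ₀ ++ (L ʳ++ R)) p Post
    exposeRight▹ σ₀ L (right (r ∷ wr) Rs E refl refl wr≤ sizes Q≤ z≡) slack fit s =
      s (right wr Rs E refl refl (≤-trans (n≤1+n _) wr≤) sizes Q≤ z≡)
        (right (r ∷ wr) Rs E refl refl wr≤ sizes Q≤ z≡)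
    exposeRight▹ {S = S} {Q} {p = p} {u} σ₀ L
      (right [] ((b ∷ blk) ∷ Rs) E refl refl wr≤ (b≡ All.∷ sizes) Q≤ refl) slack fit s =
      weaken▹ (≤-reflexive cost)
        (loadAt▹ σ₀ L (b ∷ blk) fit′
          (s (right blk Rs E refl refl (≤-trans (n≤1+n _) b≤) sizes Q≤′ refl)
             (right (b ∷ blk) Rs E refl refl b≤ sizes Q≤′ refl)))
      where
      b≤ : length (b ∷ blk) ≤ B + B + 4
      b≤ = ≤-trans (≤-reflexive b≡) (≤-trans (m≤m+n B B) (m≤m+n (B + B) 4))
      ρ = length Rs
      cost : B + (B * ρ + (E + E) + u) ≡ B * suc ρ + (E + E) + u
      cost = arith ρ
        where
        arith : ∀ ρ → B + (B * ρ + (E + E) + u) ≡ B * suc ρ + (E + E) + u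
        arith ρ = solve (B ∷ ρ ∷ E ∷ u ∷ [])
      sum : suc (length S) ≡ B + B * ρ
      sum = trans (length-++ (b ∷ blk)) (cong₂ _+_ b≡ (length-concat sizes))
      Q≤′ : Q ≤ B * ρ + B + 2 + E
      Q≤′ = ≤-trans slack (≤-trans (≤-reflexive (cong (2 +_) sum))
        (lin {0} {0} E z≤n (arith ρ)))
        where
        arith : ∀ ρ → 0 + (2 + (B + B * ρ)) + E ≡ 0 + (B * ρ + B + 2 + E)
        arith ρ = solve (B ∷ ρ ∷ E ∷ [])
      fit′ : cachedItems σ₀ + (cachedItems L + (length (b ∷ blk) + cachedItems (map onDisk Rs))) ≤ M
      fit′ = ≤-trans (≤-reflexive (cong (λ m → cachedItems σ₀ + (cachedItems L + m))
        (trans (cong₂ _+_ b≡ (cachedItems-onDisk Rs)) (+-identityʳ B)))) fit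
    exposeRight▹ σ₀ L (right [] ([] ∷ Rs) E refl S≡ wr≤ (refl All.∷ sizes) Q≤ z≡) slack fit s
      = contradiction 0<B (<-irrefl refl)

    -- With a full window there are `2 * B + 4 + B * ρ` stable groups, so the slack forces an excess
    -- of at least B + 1. Giving up B of it releases 2B units: one B for the store, the other for
    -- the block added to the potential.
    push▹ : ∀ {R g S Q z p u} σ₀ L → Right R S Q z →
      suc (length S) ≤ 2 + Q →
      (∀ {R′ z′} → Right R′ (g ∷ S) Q z′ → Spec (z′ + u) (σ₀ ++ (L ʳ++ R′)) p Post) →
      Spec (z + u) (σ₀ ++ (L ʳ++ (cached g ∷ R))) p Post
    push▹ {g = g} {S} {Q} {p = p} {u} σ₀ L (right wr Rs E refl refl wr≤ sizes Q≤ refl) slack s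
      with length wr ≟ B + B + 4
    ... | no wr≢ = s (right (g ∷ wr) Rs E refl refl (≤∧≢⇒< wr≤ wr≢) sizes Q≤ refl)
    ... | yes wr≡ =
      weaken▹ (≤-reflexive cost)
        (subst (λ σ → Spec (B + (B * suc ρ + (E′ + E′) + u)) σ p Post) (sym store≡)
          (storeAt▹ σ₀ (map cached new ʳ++ L) old (≤-reflexive old≡)
            (subst (λ σ → Spec (B * suc ρ + (E′ + E′) + u) σ p Post) store≡′
              (s (right new (old ∷ Rs) E′ refl
                   (trans (cong (_++ concat Rs) (sym (take++drop≡id (B + 5) (g ∷ wr)))) (++-assoc new old _))
                   new≤ (old≡ All.∷ sizes) Q≤′ refl)))))
      where
      ρ = length Rs
      -- Of 2B + 5 groups, the B farthest from the frontier are stored, forming a full block as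
      -- `sizes` demands. Keeping B + 5 stays within the limit because B is positive.
      new = take (B + 5) (g ∷ wr)
      old = drop (B + 5) (g ∷ wr)
      X = map onDisk Rs
      E′ = E ∸ B
      B≤E : B ≤ E
      B≤E = lin {suc (length wr + length (concat Rs)) + Q} {2 + Q + (B * ρ + B + 2 + E)} 1
        (+-mono-≤ (≤-trans (≤-reflexive (cong suc (sym (length-++ wr)))) slack) Q≤)
        (trans (arith ρ) (cong₂ (λ a b → suc (a + b) + Q + E) (sym wr≡) (sym (length-concat sizes))))
        where
        arith : ∀ ρ → 2 + Q + (B * ρ + B + 2 + E) + B + 1 ≡ suc (B + B + 4 + B * ρ) + Q + E
        arith ρ = solve (B ∷ ρ ∷ E ∷ Q ∷ [])
      E≡ : B + E′ ≡ E
      E≡ = m+[n∸m]≡n B≤E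
      cost : B + (B * suc ρ + (E′ + E′) + u) ≡ B * ρ + (E + E) + u
      cost = trans (arith ρ E′) (cong (λ e → B * ρ + (e + e) + u) E≡)
        where
        arith : ∀ ρ e → B + (B * suc ρ + (e + e) + u) ≡ B * ρ + (B + e + (B + e)) + u
        arith ρ e = solve (B ∷ ρ ∷ e ∷ u ∷ [])
      Q≤′ : Q ≤ B * suc ρ + B + 2 + E′
      Q≤′ = ≤-trans Q≤ (≤-reflexive (trans (cong (B * ρ + B + 2 +_) (sym E≡)) (arith ρ E′)))
        where
        arith : ∀ ρ e → B * ρ + B + 2 + (B + e) ≡ B * suc ρ + B + 2 + e
        arith ρ e = solve (B ∷ ρ ∷ e ∷ [])
      old≡ : length old ≡ B
      old≡ = trans (length-drop (B + 5) (g ∷ wr)) (trans (cong (λ m → suc m ∸ (B + 5)) wr≡)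
        (trans (cong (_∸ (B + 5)) arith) (m+n∸m≡n (B + 5) B)))
        where
        arith : suc (B + B + 4) ≡ B + 5 + B
        arith = solve (B ∷ [])
      new≤ : length new ≤ B + B + 4
      new≤ = ≤-trans (≤-reflexive (length-take (B + 5) (g ∷ wr))) (≤-trans (m⊓n≤m (B + 5) _) (lin 0 0<B arith))
        where
        arith : B + (B + 5) + 0 ≡ 1 + (B + B + 4)
        arith = solve (B ∷ [])
      store≡ : σ₀ ++ (L ʳ++ (cached g ∷ map cached wr ++ X)) ≡
               σ₀ ++ ((map cached new ʳ++ L) ʳ++ (map cached old ++ X))
      store≡ = cong (σ₀ ++_) (calc
        L ʳ++ (map cached (g ∷ wr) ++ X)
          ≡⟨ cong (λ gs → L ʳ++ (map cached gs ++ X)) (take++drop≡id (B + 5) (g ∷ wr)) ⟨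
        L ʳ++ (map cached (new ++ old) ++ X)
          ≡⟨ cong (λ Y → L ʳ++ (Y ++ X)) (map-++ cached new old) ⟩
        L ʳ++ ((map cached new ++ map cached old) ++ X)
          ≡⟨ cong (L ʳ++_) (++-assoc (map cached new) _ _) ⟩
        L ʳ++ (map cached new ++ map cached old ++ X)
          ≡⟨ ʳ++-ʳ++ (map cached new) ⟨
        (map cached new ʳ++ L) ʳ++ (map cached old ++ X) ∎)
      store≡′ : σ₀ ++ (L ʳ++ (map cached new ++ onDisk old ∷ X)) ≡
                σ₀ ++ ((map cached new ʳ++ L) ʳ++ (onDisk old ∷ X))
      store≡′ = cong (σ₀ ++_) (sym (ʳ++-ʳ++ (map cached new)))

  -- Program steps at a cached frontier

  module _ {A : Set} {Post : Store → A → ℕ → Set} where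

    ifTrue▹ : ∀ {b σ w p q} → b ≡ true → Spec w σ p Post → Spec w σ (if b then p else q) Post
    ifTrue▹ refl s = s

    ifFalse▹ : ∀ {b σ w p q} → b ≡ false → Spec w σ q Post → Spec w σ (if b then p else q) Post
    ifFalse▹ refl s = s

  module _ {Post : Store → Registers → ℕ → Set} (σ₀ L : Store) where

    mergeLeft-merge▹ : ∀ {h g R i I f r s w} → i ≡ itemCount σ₀ + itemCount L → degree h ≡ degree g →
      Post (σ₀ ++ ((cached (h ⊕ g) ∷ L) ʳ++ R)) (registers I (pred f) r s) w →
      Spec w (σ₀ ++ ((cached g ∷ cached h ∷ L) ʳ++ R)) (mergeLeft (suc i) (registers I f r s)) Post
    mergeLeft-merge▹ {h} {g} {i = i} pos h≡g post =
      read▹ σ₀ L pos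
        (read▹ σ₀ (cached h ∷ L) pos′
          (ifTrue▹ (≡ᵇ-true h≡g)
            (write▹ σ₀ L pos (delete▹ σ₀ (cached (h ⊕ g) ∷ L) pos′ (return▹ post)))))
      where
      pos′ : suc i ≡ itemCount σ₀ + suc (itemCount L)
      pos′ = trans (cong suc pos) (sym (+-suc (itemCount σ₀) (itemCount L)))

    mergeLeft-keep▹ : ∀ {h g R i I f r s w} → i ≡ itemCount σ₀ + itemCount L → degree h ≢ degree g →
      Post (σ₀ ++ ((cached g ∷ cached h ∷ L) ʳ++ R)) (registers I f r s) w →
      Spec w (σ₀ ++ ((cached g ∷ cached h ∷ L) ʳ++ R)) (mergeLeft (suc i) (registers I f r s)) Post
    mergeLeft-keep▹ {h} {i = i} pos h≢g post =
      read▹ σ₀ L pos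
        (read▹ σ₀ (cached h ∷ L) pos′
          (ifFalse▹ (≡ᵇ-false h≢g) (return▹ post)))
      where
      pos′ : suc i ≡ itemCount σ₀ + suc (itemCount L)
      pos′ = trans (cong suc pos) (sym (+-suc (itemCount σ₀) (itemCount L)))

    connectWhole▹ : ∀ {e R j I r s w u t} → j ≡ itemCount σ₀ + itemCount L → t ∸ s ≡ size e →
      Spec w (σ₀ ++ ((cached (decrement e) ∷ L) ʳ++ R))
        (mergeLeft j (registers (suc I) (suc j) r s)) Post →
      Spec w (σ₀ ++ ((cached e ∷ L) ʳ++ R))
        (connectFrontier n u t (registers I (suc j) r s)) Post
    connectWhole▹ pos a≡ s =
      read▹ σ₀ L pos (ifTrue▹ (≡ᵇ-true a≡) (emit▹ (write▹ σ₀ L pos s)))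

    connectPart▹ : ∀ {e R j I r s w u t} → j ≡ itemCount σ₀ + itemCount L → t ∸ s ≢ size e →
      2 + (cachedItems σ₀ + (cachedItems L + cachedItems R)) ≤ M →
      Spec w (σ₀ ++ ((cached (splitRest (t ∸ s) e) ∷ cached (splitTaken (t ∸ s) e) ∷ L) ʳ++ R))
        (mergeRight (suc j) (registers (suc I) (suc (suc j)) r s) >>= mergeLeft j) Post →
      Spec w (σ₀ ++ ((cached e ∷ L) ʳ++ R))
        (connectFrontier n u t (registers I (suc j) r s)) Post
    connectPart▹ pos a≢ fit s =
      read▹ σ₀ L pos (ifFalse▹ (≡ᵇ-false a≢)
        (write▹ σ₀ L pos (insertAfter▹ σ₀ L pos fit (emit▹ s))))

  -- Order and contiguity of the groups

  -- The groups before the frontier in reverse order, the head g kept apart;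
  -- m nodes follow them.
  data Actives (g : Group) : ℕ → List Group → Set where
    head : ∀ {m} → begin g + (size g + m) ≡ suc n → Actives g m []
    next : ∀ {m e es} → begin e + (size e + m) ≡ suc n → 0 < size e →
           degree (top g es) < degree e → Actives g (size e + m) es → Actives g m (e ∷ es)

  -- Stored degrees, all above D.
  data Stables : ℕ → List Group → Set where
    none : ∀ {D} → Stables D []
    next : ∀ {D q S} → begin q + (size q + total S) ≡ suc n → 0 < size q →
           D < degree q → Stables (degree q) S → Stables D (q ∷ S)

  module _ {A : Set} {Post : Store → A → ℕ → Set} where

    -- Here `I` is already advanced, while D bounds the stored degrees as before the advance. The
    -- remainder e has thus caught up by one and can coincide in degree with the first stable group,
    -- but with no later one. The two continuations are the two outcomes of that comparison.
    mergeRight▹ : ∀ {e R S Q z u D j I f s} {k : Registers → Prog A} σ₀ L →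
      Right R S Q z → Q ≤ 2 + length S →
      cachedItems σ₀ + (cachedItems (cached e ∷ L) + B) ≤ M →
      j ≡ itemCount σ₀ + itemCount L → s ≡ total S →
      degree e + I ≡ suc D → Stables D S →
      (∀ {R′ z′} → Right R′ S Q z′ → Stables (degree e + I) S →
        Spec (z′ + u) (σ₀ ++ ((cached e ∷ L) ʳ++ R′)) (k (registers I f (length S) (total S))) Post) →
      (∀ {R′ z′ q S′} → S ≡ q ∷ S′ → Right R′ S′ Q z′ → Stables (degree e + I) S′ →
        Spec (z′ + u) (σ₀ ++ ((cached (e ⊕ q) ∷ L) ʳ++ R′)) (k (registers I f (length S′) (total S′))) Post) →
      Spec (z + u) (σ₀ ++ ((cached e ∷ L) ʳ++ R)) (mergeRight j (registers I f (length S) s) >>= k) Post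
    mergeRight▹ {S = []} σ₀ L ri slack fit pos refl d≡ none keep merge = keep ri none
    mergeRight▹ {e} {S = q ∷ S} {D = D} {j = j} {I} {f} {k = k} σ₀ L ri slack fit pos refl d≡
      (next b 0<q D<q st) keep merge =
      exposeRight▹ σ₀ (cached e ∷ L) ri slack fit λ rest whole →
        read▹ σ₀ L pos (read▹ σ₀ (cached e ∷ L) pos′ (branch rest whole))
      where
      pos′ : suc j ≡ itemCount σ₀ + suc (itemCount L)
      pos′ = trans (cong suc pos) (sym (+-suc (itemCount σ₀) (itemCount L)))
      e≤q : degree e + I ≤ degree q
      e≤q = ≤-trans (≤-reflexive d≡) D<q
      I≤q : I ≤ degree q
      I≤q = ≤-trans (m≤n+m I (degree e)) e≤q
      branch : ∀ {R′ z′} → Right R′ S _ z′ → Right (cached q ∷ R′) (q ∷ S) _ z′ →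
        Spec _ (σ₀ ++ ((cached q ∷ cached e ∷ L) ʳ++ R′))
          ((if degree e ≡ᵇ degree q ∸ I
            then write j (e ⊕ q) (delete (suc j)
                   (return (registers I f (length S) (size q + total S ∸ size q))))
            else return (registers I f (suc (length S)) (size q + total S))) >>= k) Post
      branch rest whole with degree e ≟ degree q ∸ I
      ... | yes e≡ rewrite ≡ᵇ-true e≡ =
        write▹ σ₀ L pos (delete▹ σ₀ (cached (e ⊕ q) ∷ L) pos′
          (subst (λ m → Spec _ _ (k (registers I f (length S) m)) Post) (sym (m+n∸m≡n (size q) (total S)))
            (merge refl rest (subst (λ D → Stables D S) q≡ st))))
        where
        q≡ : degree q ≡ degree e + I
        q≡ = trans (sym (m∸n+n≡m I≤q)) (cong (_+ I) (sym e≡))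
      ... | no e≢ rewrite ≡ᵇ-false e≢ = keep whole (next b 0<q (≤∧≢⇒< e≤q q≢) st)
        where
        q≢ : degree e + I ≢ degree q
        q≢ eq = e≢ (trans (sym (m+n∸n≡m (degree e) I)) (cong (_∸ I) eq))

  room : ∀ {x y} k → k ≤ 8 → x ≤ B + B → y ≤ B + B + 4 → k + (x + y) ≤ M
  room k k≤8 x≤ y≤ = ≤-trans (+-mono-≤ k≤8 (+-mono-≤ x≤ y≤)) roomy

  -- Potential of the descending phase

  -- The groups T around the frontier that may differ from those initially in the
  -- list, with the groups of the pair active (leftPair) or separated by the
  -- boundary to the stable groups (rightPair).  Q counts the stable groups not
  -- belonging to the pair.
  data Trail (I : ℕ) : List Group → List Group → ℕ → Set where
    lone      : ∀ {e S} → Trail I (e ∷ []) S (length S)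
    rightPair : ∀ {e q S} → suc (degree e) + I ≡ degree q → Trail I (e ∷ []) (q ∷ S) (length S)
    leftPair  : ∀ {e h S} → degree e ≡ suc (degree h) → Trail I (e ∷ h ∷ []) S (length S)

  -- Up to two stable groups are gained per group of xs, hence four units of
  -- credit each; the first four are for entering the settled phase.
  credit : List Group → ℕ
  credit xs = 4 + 4 * length xs

  activeRegisters : ℕ → List Group → List Group → Registers
  activeRegisters I es S = registers I (suc (length es)) (length S) (total S)

  -- Moving the frontier to its place

  data FrontierA (t I : ℕ) (g : Group) (σ : Store) (ρ : Registers) (w : ℕ) : Set where
    inTrail : ∀ {L R e T xs S Q v z} →
      σ ≡ cached g ∷ (L ʳ++ (map cached (e ∷ T) ʳ++ R)) →
      Left L xs v → Right R S Q z → Trail I (e ∷ T) S Q →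
      Actives g (total S) (e ∷ T ++ xs) → Stables (degree e + I) S →
      total S < t → t ≤ size e + total S →
      ρ ≡ activeRegisters I (e ∷ T ++ xs) S → v + (z + credit xs) ≤ w → FrontierA t I g σ ρ w
    atHead : ∀ {R S z} →
      σ ≡ cached g ∷ R → Right R S (length S) z →
      Actives g (total S) [] → Stables (degree g + I) S →
      total S < t → t ≤ size g + total S →
      ρ ≡ activeRegisters I [] S → z ≤ w → FrontierA t I g σ ρ w

  -- The ids from `begin g` to n are those of the head group and of the m nodes behind it. Hence the
  -- search for the frontier stops at the head at the latest.
  head-reach : ∀ {g m t} → Actives g m [] → begin g + t ≤ suc n → t ≤ size g + m
  head-reach {g} (head b) cap = +-cancelˡ-≤ (begin g) _ _ (≤-trans cap (≤-reflexive (sym b)))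

  raise-Stables : ∀ {I d e S} → d < degree e → begin e + (size e + total S) ≡ suc n → 0 < size e →
                  Stables (degree e + I) S → Stables (d + I) (raise I e ∷ S)
  raise-Stables {I} h<e b 0<e st = next b 0<e (+-monoˡ-< I h<e) st

  -- Once the frontier leaves e, all stable groups count. That adds at most two to Q: e, and the
  -- other half of a right pair. The cost of four is met by the group of xs that becomes the new
  -- frontier, or by the first four units if the head does.
  stabiliseLone▹ : ∀ {L R g e S Q v z s t I} xs → Left L xs v → Right R S Q z → Trail I (e ∷ []) S Q →
    Actives g (total S) (e ∷ xs) → Stables (degree e + I) S → s ≡ total S → total S < t →
    begin g + t ≤ suc n →
    Spec (v + (z + credit xs)) (cached g ∷ (L ʳ++ (cached e ∷ R)))
      (stabiliseUntil t I (suc (suc (length xs))) (length S) s) (FrontierA t I g)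
  stabiliseLone▹ {L} {R} {g} {e} {S} {Q} {v} {z} {s} {t} {I} xs le ri tr (next b 0<e h<e act) st refl s<t cap
    with size e + total S <? t
  ... | no e+s≮t =
    read▹ (cached g ∷ []) L (cong suc (sym (Left-itemCount le)))
      (ifFalse▹ (<ᵇ-false (≤-trans (≮⇒≥ e+s≮t) (≤-reflexive (+-comm (size e) (total S))))) (return▹
        (inTrail refl le ri tr (next b 0<e h<e act) st s<t (≮⇒≥ e+s≮t) refl ≤-refl)))
  ... | yes e+s<t =
    read▹ (cached g ∷ []) L pos
      (ifTrue▹ (<ᵇ-true (subst (_< t) (+-comm (size e) (total S)) e+s<t))
        (write▹ (cached g ∷ []) L pos (pushed xs le act h<e)))
    where
    pos = cong suc (sym (Left-itemCount le))
    trail-slack : ∀ {e S Q} → Trail I (e ∷ []) S Q → suc (length S) ≤ Q + 2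
    trail-slack lone          = ≤-trans (n≤1+n _) (≤-reflexive (+-comm 2 _))
    trail-slack (rightPair _) = ≤-reflexive (+-comm 2 _)
    ri′ = Right-raise {Q′ = suc (length S)} 2 (trail-slack tr) ri
    pushed : ∀ xs {L v} → Left L xs v → Actives g (size e + total S) xs → degree (top g xs) < degree e →
      Spec (v + (z + credit xs)) (cached g ∷ (L ʳ++ (cached (raise I e) ∷ R)))
        (stabiliseUntil t I (suc (length xs)) (suc (length S)) (total S + size e)) (FrontierA t I g)
    pushed [] {v = v} le act h<e rewrite Left-[] le =
      weaken▹ (≤-reflexive (arith v z))
        (push▹ (cached g ∷ []) [] ri′ (m≤n+m _ 2) λ ri″ →
          read▹ [] [] refl (ifFalse▹ (<ᵇ-false (≤-trans reach (≤-reflexive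
              (trans (+-comm (size g) _) (cong (_+ size g) (+-comm (size e) (total S)))))))
            (return▹ (atHead refl ri″ act (raise-Stables h<e b 0<e st) e+s<t reach
              (cong (registers I 1 (suc (length S))) (+-comm (total S) (size e))) (m≤m+n _ _)))))
      where
      arith : ∀ v z → z + 4 + v ≡ v + (z + 4)
      arith v z = solve (v ∷ z ∷ [])
      reach = head-reach act cap
    pushed (x ∷ xs) {L} {v} le act h<e =
      weaken▹ (≤-reflexive (arith v z (length xs)))
        (push▹ {u = v + 4 * suc (length xs)} (cached g ∷ []) L ri′ (m≤n+m _ 2) λ {R″} {z″} ri″ →
          weaken▹ (≤-reflexive (arith′ v z″ (length xs)))
            (exposeFront▹ (cached g ∷ []) R″ le (room 1 (s≤s z≤n) ≤-refl (Right-cached ri″)) λ le′ _ →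
              stabiliseLone▹ xs le′ ri″ lone act (raise-Stables h<e b 0<e st)
                (+-comm (total S) (size e)) e+s<t cap))
      where
      arith : ∀ v z m → z + 4 + (v + 4 * suc m) ≡ v + (z + (4 + 4 * suc m))
      arith v z m = solve (v ∷ z ∷ m ∷ [])
      arith′ : ∀ v z m → v + (z + (4 + 4 * m)) ≡ z + (v + 4 * suc m)
      arith′ v z m = solve (v ∷ z ∷ m ∷ [])

  stabiliseTrail▹ : ∀ {L R g T xs S Q v z t I} → Left L xs v → Right R S Q z → Trail I T S Q →
    Actives g (total S) (T ++ xs) → Stables (degree (top g (T ++ xs)) + I) S → total S < t →
    begin g + t ≤ suc n →
    Spec (v + (z + credit xs)) (cached g ∷ (L ʳ++ (map cached T ʳ++ R)))
      (stabiliseUntil t I (suc (length (T ++ xs))) (length S) (total S)) (FrontierA t I g)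
  stabiliseTrail▹ {xs = xs} le ri lone act st s<t cap = stabiliseLone▹ xs le ri lone act st refl s<t cap
  stabiliseTrail▹ {xs = xs} le ri (rightPair gap) act st s<t cap =
    stabiliseLone▹ xs le ri (rightPair gap) act st refl s<t cap
  stabiliseTrail▹ {L} {R} {g} {T = e ∷ h ∷ []} {xs} {S} {v = v} {z} {t} {I} le ri (leftPair gap)
    (next b 0<e h<e act) st s<t cap with size e + total S <? t
  ... | no e+s≮t =
    read▹ (cached g ∷ []) (cached h ∷ L) (cong (suc ∘ suc) (sym (Left-itemCount le)))
      (ifFalse▹ (<ᵇ-false (≤-trans (≮⇒≥ e+s≮t) (≤-reflexive (+-comm (size e) (total S))))) (return▹
        (inTrail refl le ri (leftPair gap) (next b 0<e h<e act) st s<t (≮⇒≥ e+s≮t) refl ≤-refl)))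
  ... | yes e+s<t =
    read▹ (cached g ∷ []) (cached h ∷ L) pos
      (ifTrue▹ (<ᵇ-true (subst (_< t) (+-comm (size e) (total S)) e+s<t))
        (write▹ (cached g ∷ []) (cached h ∷ L) pos
          (weaken▹ (≤-reflexive (arith v z (credit xs)))
            (push▹ (cached g ∷ []) (cached h ∷ L) ri (n≤1+n _) λ {R′} {z′} ri′ →
              weaken▹ (≤-reflexive (arith′ v z′ (credit xs)))
                -- Crossing the pair is free: e moves to the stable side, but as half of a pair it
                -- remains uncounted in Q.
                (stabiliseLone▹ xs le ri′ (rightPair (cong (_+ I) (sym gap))) act (raise-Stables h<e b 0<e st)
                  (+-comm (total S) (size e)) e+s<t cap)))))
    where
    pos = cong (suc ∘ suc) (sym (Left-itemCount le))
    arith : ∀ v z c → z + (v + c) ≡ v + (z + c)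
    arith v z c = solve (v ∷ z ∷ c ∷ [])
    arith′ : ∀ v z c → v + (z + c) ≡ z + (v + c)
    arith′ v z c = solve (v ∷ z ∷ c ∷ [])

  -- Actual degrees in list order, wherever the boundary between active and stable groups lies;
  -- moving the frontier therefore preserves this list.
  rest : ℕ → List Group → List Group → List Group
  rest I T S = T ʳ++ map (lower I) S

  -- All groups but the head are 𝓡, the actual degrees being stored in T only.
  data Window (P : List Group → List Group → Set) (I : ℕ) (g : Group) (𝓡 : List Group) (Q : ℕ)
              (σ : Store) (ρ : Registers) (w : ℕ) : Set where
    window : ∀ {T S R z} →
      σ ≡ cached g ∷ (map cached T ʳ++ R) → Right R S Q z →
      Actives g (total S) T → Stables (degree (top g T) + I) S →
      length T ≤ 2 → rest I T S ≡ 𝓡 → Q ≤ length T + length S → length T + length S ≤ suc Q →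
      ρ ≡ activeRegisters I T S → z ≤ w → P T S → Window P I g 𝓡 Q σ ρ w

  lower-Actives : ∀ {I g T q S} → Actives g (size q + total S) T → degree (top g T) + I < degree q →
    0 < size q → begin q + (size q + total S) ≡ suc n → Actives g (total S) (lower I q ∷ T)
  lower-Actives {I} act D<q 0<q b = next b 0<q (m+n≤o⇒m≤o∸n _ D<q) act

  lower-Stables : ∀ {I D d S} → D + I < d → Stables d S → Stables (d ∸ I + I) S
  lower-Stables {I} {D} D<q st = subst (λ d → Stables d _) (sym (m∸n+n≡m (≤-trans (m≤n+m I D) (<⇒≤ D<q)))) st

  -- The hypothesis `far` keeps the window small: with two active groups behind the head, fewer than
  -- t nodes are stable and activation stops. As Q stays within one of the number of groups behind
  -- the head, the buffers can be moved without new credit.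
  activateWindow▹ : ∀ {g 𝓡 Q t I R T z s} S → Right R S Q z → s ≡ total S →
    Actives g (total S) T → Stables (degree (top g T) + I) S →
    length T ≤ 2 → rest I T S ≡ 𝓡 → Q ≤ length T + length S → length T + length S ≤ suc Q →
    (∀ T S → length T ≡ 2 → Actives g (total S) T → rest I T S ≡ 𝓡 → total S < t) → 0 < t →
    Spec z (cached g ∷ (map cached T ʳ++ R)) (activateUntil t I (suc (length T)) (length S) s)
      (Window (λ T S → total S < t) I g 𝓡 Q)
  activateWindow▹ [] ri refl act st T≤2 rest≡ Q≤ ≤Q far 0<t =
    return▹ (window refl ri act st T≤2 rest≡ Q≤ ≤Q refl ≤-refl 0<t)
  activateWindow▹ {g} {Q = Q} {t} {I} {R} {T} {z} (q ∷ S) ri refl act (next b 0<q D<q st) T≤2 rest≡ Q≤ ≤Q far 0<t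
    with size q + total S <? t
  ... | yes s<t = ifTrue▹ (<ᵇ-true s<t)
    (return▹ (window refl ri act (next b 0<q D<q st) T≤2 rest≡ Q≤ ≤Q refl ≤-refl s<t))
  ... | no s≮t = ifFalse▹ (<ᵇ-false (≮⇒≥ s≮t))
    (weaken▹ (≤-reflexive (+-identityʳ z))
      (exposeRight▹ {u = 0} (cached g ∷ []) (map cached T) ri slack fit λ {R′} {z′} ri′ _ →
        read▹ (cached g ∷ []) (map cached T) pos
          (write▹ (cached g ∷ []) (map cached T) pos
            (weaken▹ (m≤m+n z′ 0)
              (activateWindow▹ {T = lower I q ∷ T} S ri′ (m+n∸m≡n (size q) (total S))
                (lower-Actives {S = S} act D<q 0<q b) (lower-Stables {D = degree (top g T)} D<q st) T<2 rest≡
                (≤-trans Q≤ (≤-reflexive (+-suc _ _))) (≤-trans (≤-reflexive (sym (+-suc _ _))) ≤Q) far 0<t)))))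
    where
    T<2 : length T < 2
    T<2 = ≤∧≢⇒< T≤2 λ T≡2 → s≮t (far T (q ∷ S) T≡2 act rest≡)
    pos : suc (length T) ≡ 1 + itemCount (map cached T)
    pos = cong suc (sym (itemCount-cached T))
    slack : Q ≤ 3 + length S
    slack = ≤-trans Q≤ (≤-trans (≤-reflexive (+-suc _ _)) (+-monoˡ-≤ (length S) (s≤s T≤2)))
    fit : 1 + (cachedItems (map cached T) + B) ≤ M
    fit = ≤-trans (+-monoʳ-≤ 1 (+-monoˡ-≤ B (≤-trans (≤-reflexive (cachedItems-cached T)) T≤2)))
            (room 3 (s≤s (s≤s (s≤s z≤n))) z≤n (≤-trans (m≤m+n B B) (m≤m+n (B + B) 4)))

  stabiliseWindow▹ : ∀ {g 𝓡 Q t I R S z s} T → Right R S Q z → s ≡ total S →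
    Actives g (total S) T → Stables (degree (top g T) + I) S →
    length T ≤ 2 → rest I T S ≡ 𝓡 → Q ≤ length T + length S → length T + length S ≤ suc Q →
    total S < t → begin g + t ≤ suc n →
    Spec z (cached g ∷ (map cached T ʳ++ R)) (stabiliseUntil t I (suc (length T)) (length S) s)
      (Window (λ T S → total S < t × t ≤ size (top g T) + total S) I g 𝓡 Q)
  stabiliseWindow▹ {g} {S = S} [] ri refl act st T≤2 rest≡ Q≤ ≤Q s<t cap =
    read▹ [] [] refl (ifFalse▹ (<ᵇ-false (≤-trans reach (≤-reflexive (+-comm (size g) (total S)))))
      (return▹ (window refl ri act st T≤2 rest≡ Q≤ ≤Q refl ≤-refl (s<t , reach))))
    where reach = head-reach act cap
  stabiliseWindow▹ {g} {Q = Q} {t} {I} {R} {S} {z} (e ∷ T) ri refl (next b 0<e h<e act) st T≤2 rest≡ Q≤ ≤Q s<t cap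
    with size e + total S <? t
  ... | no e+s≮t =
    read▹ (cached g ∷ []) (map cached T) (cong suc (sym (itemCount-cached T)))
      (ifFalse▹ (<ᵇ-false (≤-trans (≮⇒≥ e+s≮t) (≤-reflexive (+-comm (size e) (total S)))))
        (return▹ (window refl ri (next b 0<e h<e act) st T≤2 rest≡ Q≤ ≤Q refl ≤-refl (s<t , ≮⇒≥ e+s≮t))))
  ... | yes e+s<t =
    read▹ (cached g ∷ []) (map cached T) pos
      (ifTrue▹ (<ᵇ-true (subst (_< t) (+-comm (size e) (total S)) e+s<t))
        (write▹ (cached g ∷ []) (map cached T) pos
          (weaken▹ (≤-reflexive (+-identityʳ z))
            (push▹ {u = 0} (cached g ∷ []) (map cached T) ri slack λ {R′} {z′} ri′ →
              weaken▹ (m≤m+n z′ 0)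
                (stabiliseWindow▹ T ri′ (+-comm (total S) (size e)) act (raise-Stables h<e b 0<e st)
                  (≤-trans (n≤1+n _) T≤2)
                  (trans (cong (λ x → T ʳ++ (x ∷ map (lower I) S)) lower-raise) rest≡)
                  (≤-trans Q≤ (≤-reflexive (sym (+-suc _ _)))) (≤-trans (≤-reflexive (+-suc _ _)) ≤Q)
                  e+s<t cap)))))
    where
    pos : suc (length T) ≡ 1 + itemCount (map cached T)
    pos = cong suc (sym (itemCount-cached T))
    lower-raise : lower I (raise I e) ≡ e
    lower-raise = cong (group (begin e) (size e)) (m+n∸n≡m (degree e) I)
    slack : suc (length S) ≤ 2 + Q
    slack = ≤-trans (s≤s (m≤n+m (length S) (length T))) (≤-trans ≤Q (n≤1+n _))

  -- Invariants between rounds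

  -- 𝓡 are the groups after the head g.  In the second case a frontier in 𝓡′ has
  -- to comprise all of its nodes.
  data Settled (g : Group) (𝓡 : List Group) (Q : ℕ) : Set where
    covered : total 𝓡 ≤ degree g → Q ≡ length 𝓡 → Settled g 𝓡 Q
    twin    : ∀ g₂ 𝓡′ → 𝓡 ≡ g₂ ∷ 𝓡′ → degree g₂ ≡ suc (degree g) → total 𝓡′ ≤ degree g →
              Q ≡ length 𝓡′ → Settled g 𝓡 Q

  -- b is the first node not extracted yet.
  data State (P : ℕ → Set) (b : ℕ) (σ : Store) (ρ : Registers) (w : ℕ) : Set where
    descending : ∀ {I g T xs L R S Q v z} →
      begin g ≡ b → P (size g) → σ ≡ cached g ∷ (L ʳ++ (map cached T ʳ++ R)) →
      Left L xs v → Right R S Q z → Trail I T S Q →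
      Actives g (total S) (T ++ xs) → Stables (degree (top g (T ++ xs)) + I) S →
      total S < degree g → ρ ≡ activeRegisters I (T ++ xs) S → v + (z + credit xs) ≤ w →
      State P b σ ρ w
    settled : ∀ {I g T R S Q z} →
      begin g ≡ b → P (size g) → σ ≡ cached g ∷ (map cached T ʳ++ R) →
      Right R S Q z → Actives g (total S) T → Stables (degree (top g T) + I) S →
      length T ≤ 2 → Settled g (rest I T S) Q → ρ ≡ activeRegisters I T S → z ≤ w →
      State P b σ ρ w

  Whatever : ℕ → Set
  Whatever _ = ⊤

  -- Advancing `iteration` lowers the stable groups exactly as the frontier is lowered, so the bound
  -- on the stored degrees remains the same number.
  tick : ∀ {d I S} → 0 < d → Stables (d + I) S → Stables (pred d + suc I) S
  tick {suc d} {I} {S} _ st = subst (λ m → Stables m S) (sym (+-suc d I)) st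

  -- Connecting at the frontier

  -- Whether or not the remainder of a split frontier group e is merged with the
  -- first stable group, at most Q stable groups are left.
  Absorbing : ℕ → Group → List Group → ℕ → Set
  Absorbing I e S Q =
    (Stables (degree e + suc I) S → length S ≤ Q) × (∀ {q S′} → S ≡ q ∷ S′ → length S′ ≤ Q)

  -- Both outcomes of `mergeRight` take the same form: e* is the remainder, possibly joined with the
  -- first stable group, and S* is what stays stable. `Absorbing` allows Q to be lowered to
  -- `length S*`, so a split needs no credit.
  split▹ : ∀ {Post e R S Q z u j I t b} σ₀ L → Right R S Q z → Q ≤ 2 + length S → Absorbing I e S Q →
    cachedItems σ₀ + cachedItems L ≤ 2 + (B + B) → j ≡ itemCount σ₀ + itemCount L →
    begin e + (size e + total S) ≡ suc n → Stables (degree e + I) S →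
    total S < t → t ≤ size e + total S → t ∸ total S ≢ size e →
    (∀ {e* S* R* z*} → Right R* S* (length S*) z* → degree e* ≡ degree e →
      begin e* + (size e* + total S*) ≡ suc n → 0 < size e* →
      t ∸ total S + (size e* + total S*) ≡ size e + total S → Stables (degree e* + suc I) S* →
      total S* ≤ total S →
      Spec (z* + u) (σ₀ ++ ((cached e* ∷ cached (splitTaken (t ∸ total S) e) ∷ L) ʳ++ R*))
        (mergeLeft j (registers (suc I) (suc (suc j)) (length S*) (total S*))) Post) →
    Spec (z + u) (σ₀ ++ ((cached e ∷ L) ʳ++ R))
      (connectFrontier n b t (registers I (suc j) (length S) (total S))) Post
  split▹ {e = e} {R} {S} {Q} {j = j} {I} {t} σ₀ L ri slack (absorb , absorb′) fit pos b≡ st s<t t≤ a≢ k =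
    connectPart▹ σ₀ L pos a≢ fit₁
      (mergeRight▹ σ₀ (cached (splitTaken a e) ∷ L) ri slack fit₂
        (trans (cong suc pos) (sym (+-suc (itemCount σ₀) (itemCount L)))) refl (+-suc (degree e) I) st
        (λ ri′ st′ → k (Right-lower (absorb st′) ri′) refl b≡′ 0<rest sum st′ ≤-refl)
        (λ {_} {_} {q} {S′} S≡ ri′ st′ →
          k (Right-lower (absorb′ S≡) ri′) refl (trans (cong (begin e + a +_) (regroup S≡)) b≡′)
            (≤-trans 0<rest (m≤m+n _ _)) (trans (cong (a +_) (regroup S≡)) sum) st′
            (≤-trans (m≤n+m (total S′) (size q)) (≤-reflexive (cong total (sym S≡))))))
    where
    a = t ∸ total S
    a≤ : a ≤ size e
    a≤ = m≤n+o⇒m∸n≤o t (total S) (≤-trans t≤ (≤-reflexive (+-comm (size e) (total S))))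
    0<rest : 0 < size e ∸ a
    0<rest = m<n⇒0<n∸m (≤∧≢⇒< a≤ a≢)
    sum : a + (size e ∸ a + total S) ≡ size e + total S
    sum = trans (sym (+-assoc a _ _)) (cong (_+ total S) (m+[n∸m]≡n a≤))
    b≡′ : begin e + a + (size e ∸ a + total S) ≡ suc n
    b≡′ = trans (+-assoc (begin e) a _) (trans (cong (begin e +_) sum) b≡)
    regroup : ∀ {q S′} → S ≡ q ∷ S′ → size e ∸ a + size q + total S′ ≡ size e ∸ a + total S
    regroup S≡ = trans (+-assoc (size e ∸ a) _ _) (cong (size e ∸ a +_) (sym (cong total S≡)))
    fit₁ : 2 + (cachedItems σ₀ + (cachedItems L + cachedItems R)) ≤ M
    fit₁ = ≤-trans (+-monoʳ-≤ 2 (≤-trans (≤-reflexive (sym (+-assoc (cachedItems σ₀) _ _)))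
             (+-mono-≤ fit (Right-cached ri)))) (room 4 (s≤s (s≤s (s≤s (s≤s z≤n)))) ≤-refl ≤-refl)
    fit₂ : cachedItems σ₀ + (2 + cachedItems L + B) ≤ M
    fit₂ = ≤-trans (≤-reflexive (arith (cachedItems σ₀) (cachedItems L)))
             (≤-trans (+-monoʳ-≤ 2 (+-monoˡ-≤ B fit))
               (room 4 (s≤s (s≤s (s≤s (s≤s z≤n)))) ≤-refl (≤-trans (m≤m+n B B) (m≤m+n (B + B) 4))))
      where
      arith : ∀ x y → x + (2 + y + B) ≡ 2 + (x + y + B)
      arith x y = solve (x ∷ y ∷ B ∷ [])

  -- From `total S < t ≤ degree g` it follows that the decremented head degree is still at least
  -- `total S`. If the head splits, the remainder keeps the old degree, one above that of the new
  -- head, and the two form a `twin`.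
  headFrontier▹ : ∀ {g R S Q z I t b} → Right R S Q z → Q ≤ 2 + length S → Absorbing I g S Q →
    Actives g (total S) [] → Stables (degree g + I) S →
    total S < t → t ≤ size g + total S → t ≤ degree g →
    Settled (decrement g) (map (lower (suc I)) S) Q →
    Spec z (cached g ∷ R) (connectFrontier n b t (activeRegisters I [] S)) (State Whatever (begin g))
  headFrontier▹ {g} {R} {S} {Q} {z} {I} {t} ri slack absorb (head b≡) st s<t t≤ t≤d whole with t ∸ total S ≟ size g
  ... | yes a≡ = connectWhole▹ [] [] refl a≡
    (return▹ (settled refl tt refl ri (head b≡) (tick 0<d st) z≤n whole refl ≤-refl))
    where
    0<d : 0 < degree g
    0<d = ≤-trans (s≤s z≤n) (≤-trans s<t t≤d)
  ... | no a≢ = weaken▹ (≤-reflexive (+-identityʳ z))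
    (split▹ {u = 0} [] [] ri slack absorb z≤n refl b≡ st s<t t≤ a≢
      λ {e*} {S*} {_} {z*} ri* d* b* 0<e* sum st* tot → weaken▹ (m≤m+n z* 0)
        (return▹ (settled {T = e* ∷ []} refl tt refl ri*
          (next b* 0<e* (≤-trans (≤-reflexive (suc-pred-pos 0<d)) (≤-reflexive (sym d*)))
            (head (trans (cong (begin g +_) sum) b≡)))
          st* (s≤s z≤n)
          (twin e* _ refl (trans d* (sym (suc-pred-pos 0<d)))
            (≤-trans (≤-reflexive (total-lower (suc I) S*)) (≤-trans tot (<⇒≤pred (≤-trans s<t t≤d))))
            (sym (length-map (lower (suc I)) S*)))
          refl ≤-refl)))
    where
    0<d : 0 < degree g
    0<d = ≤-trans (s≤s z≤n) (≤-trans s<t t≤d)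

  -- For a right pair, the remainder of e has exactly the degree to which q drops in this round, so
  -- the strict order excludes that they stay apart: the split flows back into the pair.
  trail-absorbing : ∀ {I e T S Q} → Trail I (e ∷ T) S Q → Absorbing I e S Q
  trail-absorbing lone            = (λ _ → ≤-refl) , λ { refl → n≤1+n _ }
  trail-absorbing {I} {e} (rightPair gap) =
    (λ { (next _ _ lt _) → contradiction lt (<-irrefl (trans (+-suc (degree e) I) gap)) }) , λ { refl → ≤-refl }
  trail-absorbing (leftPair _)    = (λ _ → ≤-refl) , λ { refl → n≤1+n _ }

  trail-slack : ∀ {I T S Q} → Trail I T S Q → Q ≤ 2 + length S
  trail-slack lone          = m≤n+m _ 2
  trail-slack (rightPair _) = m≤n+m _ 3
  trail-slack (leftPair _)  = m≤n+m _ 2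

  trail-≤ : ∀ {I e S Q} → Trail I (e ∷ []) S Q → length S ≤ Q + 2
  trail-≤ lone          = m≤m+n _ 2
  trail-≤ (rightPair _) = ≤-trans (n≤1+n _) (≤-reflexive (+-comm 2 _))

  trail-tick : ∀ {I e S Q} → 0 < degree e → Trail I (e ∷ []) S Q → Trail (suc I) (decrement e ∷ []) S Q
  trail-tick _ lone = lone
  trail-tick {I} {e} 0<d (rightPair gap) =
    rightPair (trans (cong (_+ suc I) (suc-pred-pos 0<d)) (trans (+-suc (degree e) I) gap))

  budget : ∀ v {c u} z → v + c ≤ u → v + (z + c) ≤ z + u
  budget v {c} {u} z le = ≤-trans (≤-reflexive (arith v c z)) (+-monoʳ-≤ z le)
    where
    arith : ∀ v c z → v + (z + c) ≡ z + (v + c)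
    arith v c z = solve (v ∷ c ∷ z ∷ [])

  -- The predecessor x merges with the lowered part of e if its degree is one less than that of e.
  -- If all of e merges, the result is a lone group and the other half of a right pair starts to
  -- count; `z₀` is the potential after that. If x does not merge, `keep` puts it back; for a left
  -- pair this case is refuted by the gap of one.
  frontierNext▹ : ∀ {t I g L R e x xs S Q v z z₀ u b} → Left L xs v →
    Right R S (length S) z₀ → v + (z₀ + credit xs) ≤ z + u → v + credit xs ≤ u →
    Right R S Q z → Q ≤ 2 + length S → Absorbing I e S Q →
    (degree x ≢ pred (degree e) →
      Left (cached x ∷ L) (x ∷ xs) v × Trail I (e ∷ []) S Q × v + credit (x ∷ xs) ≤ u) →
    Actives g (total S) (e ∷ x ∷ xs) → Stables (degree e + I) S →
    total S < t → t ≤ size e + total S → t ≤ degree g →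
    Spec (z + u) (cached g ∷ ((cached e ∷ cached x ∷ L) ʳ++ R))
      (connectFrontier n b t (activeRegisters I (e ∷ x ∷ xs) S)) (State Whatever (begin g))
  frontierNext▹ {t} {I} {g} {L} {R} {e} {x} {xs} {S} {v = v} {z} {z₀} {u} le ri₀ w₀ w₁ ri slack absorb keep
    (next b 0<e x<e (next bx 0<x y<x act)) st s<t t≤ t≤d = result
    where
    σ₀ = cached g ∷ []
    j = 2 + length xs
    pos : j ≡ 1 + suc (itemCount L)
    pos = cong (suc ∘ suc) (sym (Left-itemCount le))
    pos′ : suc (length xs) ≡ 1 + itemCount L
    pos′ = cong suc (sym (Left-itemCount le))
    0<d : 0 < degree e
    0<d = ≤-trans (s≤s z≤n) x<e
    assoc : ∀ {a m} → a + m ≡ size e + total S → size x + a + m ≡ size x + (size e + total S)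
    assoc {a} {m} eq = trans (+-assoc (size x) a m) (cong (size x +_) eq)
    whole : Spec (z + u) (σ₀ ++ ((cached (decrement e) ∷ cached x ∷ L) ʳ++ R))
      (mergeLeft j (registers (suc I) (suc j) (length S) (total S))) (State Whatever (begin g))
    whole with degree x ≟ pred (degree e)
    ... | yes x≡ = mergeLeft-merge▹ σ₀ L pos′ x≡
      (descending {T = x ⊕ decrement e ∷ []} refl tt refl le ri₀ lone
        (next (trans (cong (begin x +_) (assoc refl)) bx) (≤-trans 0<x (m≤m+n _ _)) y<x
          (subst (λ m → Actives g m xs) (sym (assoc refl)) act))
        (subst (λ d → Stables (d + suc I) S) (sym x≡) (tick 0<d st))
        (≤-trans s<t t≤d) refl w₀)
    ... | no x≢ with keep x≢
    ...   | le′ , tr , w₂ = mergeLeft-keep▹ σ₀ L pos′ x≢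
      (descending {T = decrement e ∷ []} refl tt refl le′ ri (trail-tick 0<d tr)
        (next b 0<e (≤∧≢⇒< (<⇒≤pred x<e) x≢) (next bx 0<x y<x act)) (tick 0<d st)
        (≤-trans s<t t≤d) refl (budget v z w₂))
    part : t ∸ total S ≢ size e → Spec (z + u) (σ₀ ++ ((cached e ∷ cached x ∷ L) ʳ++ R))
      (connectFrontier n _ t (registers I (suc j) (length S) (total S))) (State Whatever (begin g))
    part a≢ = split▹ σ₀ (cached x ∷ L) ri slack absorb (s≤s (s≤s (Left-cached le))) pos b st s<t t≤ a≢
      λ {e*} {S*} {R*} {z*} ri* d* b* 0<e* sum st* tot →
        split-off ri* d* b* 0<e* sum st* (≤-trans (s≤s tot) (≤-trans s<t t≤d))
      where
      a = t ∸ total S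
      split-off : ∀ {e* S* R* z*} → Right R* S* (length S*) z* → degree e* ≡ degree e →
        begin e* + (size e* + total S*) ≡ suc n → 0 < size e* →
        a + (size e* + total S*) ≡ size e + total S → Stables (degree e* + suc I) S* →
        total S* < degree g →
        Spec (z* + u) (σ₀ ++ ((cached e* ∷ cached (splitTaken a e) ∷ cached x ∷ L) ʳ++ R*))
          (mergeLeft j (registers (suc I) (suc (suc j)) (length S*) (total S*))) (State Whatever (begin g))
      split-off {e*} {S*} {R*} {z*} ri* d* b* 0<e* sum st* tot with degree x ≟ pred (degree e)
      ... | yes x≡ = mergeLeft-merge▹ σ₀ L pos′ x≡
        (descending {T = e* ∷ x ⊕ splitTaken a e ∷ []} refl tt refl le ri*
          (leftPair (trans d* (trans (sym (suc-pred-pos 0<d)) (cong suc (sym x≡)))))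
          (next b* 0<e* (≤-trans x<e (≤-reflexive (sym d*)))
            (next (trans (cong (begin x +_) (assoc sum)) bx) (≤-trans 0<x (m≤m+n _ _)) y<x
              (subst (λ m → Actives g m xs) (sym (assoc sum)) act)))
          st* tot refl (budget v z* w₁))
      ... | no x≢ with keep x≢
      ...   | le′ , _ , w₂ = mergeLeft-keep▹ σ₀ L pos′ x≢
        (descending {T = e* ∷ splitTaken a e ∷ []} refl tt refl le′ ri*
          (leftPair (trans d* (sym (suc-pred-pos 0<d))))
          (next b* 0<e* (≤-trans (≤-reflexive (suc-pred-pos 0<d)) (≤-reflexive (sym d*)))
            (next (trans (cong (begin e +_) sum) b) (m<n⇒0<n∸m s<t) (≤∧≢⇒< (<⇒≤pred x<e) x≢)
              (subst (λ m → Actives g m (x ∷ xs)) (sym sum) (next bx 0<x y<x act))))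
          st* tot refl (budget v z* w₂))
    result : Spec (z + u) (cached g ∷ ((cached e ∷ cached x ∷ L) ʳ++ R))
      (connectFrontier n _ t (registers I (suc j) (length S) (total S))) (State Whatever (begin g))
    result with t ∸ total S ≟ size e
    ... | yes a≡ = connectWhole▹ σ₀ (cached x ∷ L) pos a≡ whole
    ... | no a≢  = part a≢

  -- The predecessor is the head, whose degree does not change. If all of e merges into it, exactly
  -- the `total S < degree g` stable nodes remain behind it, which is `covered`; the four units pay
  -- for counting all stable groups.
  frontierFirst▹ : ∀ {t I g R e S Q z b} →
    Right R S Q z → Trail I (e ∷ []) S Q →
    Actives g (total S) (e ∷ []) → Stables (degree e + I) S →
    total S < t → t ≤ size e + total S → t ≤ degree g →
    Spec (z + 4) (cached g ∷ cached e ∷ R)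
      (connectFrontier n b t (activeRegisters I (e ∷ []) S)) (State Whatever (begin g))
  frontierFirst▹ {t} {I} {g} {R} {e} {S} {z = z} ri tr (next b 0<e g<e (head bg)) st s<t t≤ t≤d = result
    where
    0<d : 0 < degree e
    0<d = ≤-trans (s≤s z≤n) g<e
    assoc : ∀ {a m} → a + m ≡ size e + total S → size g + a + m ≡ size g + (size e + total S)
    assoc {a} {m} eq = trans (+-assoc (size g) a m) (cong (size g +_) eq)
    whole : Spec (z + 4) (cached g ∷ cached (decrement e) ∷ R)
      (mergeLeft 1 (registers (suc I) 2 (length S) (total S))) (State Whatever (begin g))
    whole with degree g ≟ pred (degree e)
    ... | yes g≡ = mergeLeft-merge▹ [] [] refl g≡
      (settled {T = []} refl tt refl (Right-raise 2 (trail-≤ tr) ri)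
        (head (trans (cong (begin g +_) (assoc refl)) bg))
        (subst (λ d → Stables (d + suc I) S) (sym g≡) (tick 0<d st)) z≤n
        (covered (≤-trans (≤-reflexive (total-lower (suc I) S)) (<⇒≤ (≤-trans s<t t≤d)))
          (sym (length-map (lower (suc I)) S)))
        refl ≤-refl)
    ... | no g≢ = mergeLeft-keep▹ [] [] refl g≢
      (descending {T = decrement e ∷ []} refl tt refl Left-empty ri (trail-tick 0<d tr)
        (next b 0<e (≤∧≢⇒< (<⇒≤pred g<e) g≢) (head bg)) (tick 0<d st)
        (≤-trans s<t t≤d) refl ≤-refl)
    part : t ∸ total S ≢ size e → Spec (z + 4) (cached g ∷ cached e ∷ R)
      (connectFrontier n _ t (registers I 2 (length S) (total S))) (State Whatever (begin g))
    part a≢ = split▹ [] (cached g ∷ []) ri (trail-slack tr) (trail-absorbing tr) (s≤s z≤n) refl b st s<t t≤ a≢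
      λ ri* d* b* 0<e* sum st* tot → split-off ri* d* b* 0<e* sum st* (≤-trans (s≤s tot) (≤-trans s<t t≤d))
      where
      a = t ∸ total S
      split-off : ∀ {e* S* R* z*} → Right R* S* (length S*) z* → degree e* ≡ degree e →
        begin e* + (size e* + total S*) ≡ suc n → 0 < size e* →
        a + (size e* + total S*) ≡ size e + total S → Stables (degree e* + suc I) S* →
        total S* < degree g →
        Spec (z* + 4) (cached g ∷ cached (splitTaken a e) ∷ cached e* ∷ R*)
          (mergeLeft 1 (registers (suc I) 3 (length S*) (total S*))) (State Whatever (begin g))
      split-off {e*} {S*} {R*} {z*} ri* d* b* 0<e* sum st* tot with degree g ≟ pred (degree e)
      ... | yes g≡ = mergeLeft-merge▹ [] [] {R = cached e* ∷ R*} refl g≡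
        (descending {T = e* ∷ []} refl tt refl Left-empty ri* lone
          (next b* 0<e* (≤-trans g<e (≤-reflexive (sym d*)))
            (head (trans (cong (begin g +_) (assoc sum)) bg)))
          st* tot refl ≤-refl)
      ... | no g≢ = mergeLeft-keep▹ [] [] {R = cached e* ∷ R*} refl g≢
        (descending {T = e* ∷ splitTaken a e ∷ []} refl tt refl Left-empty ri*
          (leftPair (trans d* (sym (suc-pred-pos 0<d))))
          (next b* 0<e* (≤-trans (≤-reflexive (suc-pred-pos 0<d)) (≤-reflexive (sym d*)))
            (next (trans (cong (begin e +_) sum) b) (m<n⇒0<n∸m s<t) (≤∧≢⇒< (<⇒≤pred g<e) g≢)
              (subst (λ m → Actives g m []) (sym sum) (head bg))))
          st* tot refl ≤-refl)
    result : Spec (z + 4) (cached g ∷ cached e ∷ R)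
      (connectFrontier n _ t (registers I 2 (length S) (total S))) (State Whatever (begin g))
    result with t ∸ total S ≟ size e
    ... | yes a≡ = connectWhole▹ [] (cached g ∷ []) refl a≡ whole
    ... | no a≢  = part a≢

  frontierTrail▹ : ∀ {t I g L R e T S Q v z b} xs → Left L xs v → Right R S Q z → Trail I (e ∷ T) S Q →
    Actives g (total S) (e ∷ T ++ xs) → Stables (degree e + I) S →
    total S < t → t ≤ size e + total S → t ≤ degree g →
    Spec (v + (z + credit xs)) (cached g ∷ (L ʳ++ (map cached (e ∷ T) ʳ++ R)))
      (connectFrontier n b t (activeRegisters I (e ∷ T ++ xs) S)) (State Whatever (begin g))
  frontierTrail▹ {I = I} {e = e} {T = h ∷ []} {S = S} {v = v} {z} xs le ri (leftPair gap) act st s<t t≤ t≤d =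
    weaken▹ (≤-reflexive (arith v z (credit xs)))
      (frontierNext▹ {z = z} le ri (≤-reflexive (sym (arith v z (credit xs)))) ≤-refl ri (m≤n+m _ 2)
        (trail-absorbing {I} {e} {h ∷ []} {S} (leftPair gap))
        (λ h≢ → contradiction (sym (cong pred gap)) h≢) act st s<t t≤ t≤d)
    where
    arith : ∀ v z c → z + (v + c) ≡ v + (z + c)
    arith v z c = solve (v ∷ z ∷ c ∷ [])
  frontierTrail▹ {g = g} {R = R} {e} {T = []} {v = v} {z} (x ∷ xs) le ri tr act st s<t t≤ t≤d =
    exposeFront▹ (cached g ∷ []) (cached e ∷ R) le fit λ {L′} {v′} le₁ le₂ →
      weaken▹ (≤-reflexive (arith v′ z (length xs)))
        -- If x merges, it leaves xs, and its four units buy the two by which Q may have to grow.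
        (frontierNext▹ {z = z} le₁ (Right-raise 2 (trail-≤ tr) ri) (≤-reflexive (arith′ v′ z (length xs)))
          (+-monoʳ-≤ v′ (+-monoʳ-≤ 4 (*-monoʳ-≤ 4 (n≤1+n _)))) ri (trail-slack tr) (trail-absorbing tr)
          (λ _ → le₂ , tr , ≤-refl) act st s<t t≤ t≤d)
    where
    arith : ∀ v z m → z + (v + (4 + 4 * suc m)) ≡ v + (z + (4 + 4 * suc m))
    arith v z m = solve (v ∷ z ∷ m ∷ [])
    arith′ : ∀ v z m → v + (z + 4 + (4 + 4 * m)) ≡ z + (v + (4 + 4 * suc m))
    arith′ v z m = solve (v ∷ z ∷ m ∷ [])
    fit : 1 + (B + B + suc (cachedItems R)) ≤ M
    fit = ≤-trans (≤-reflexive (cong suc (+-suc (B + B) _))) (room 2 (s≤s (s≤s z≤n)) ≤-refl (Right-cached ri))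
  frontierTrail▹ {T = []} {v = v} {z} [] le ri tr act st s<t t≤ t≤d rewrite Left-[] le =
    weaken▹ (m≤n+m (z + 4) v) (frontierFirst▹ ri tr act st s<t t≤ t≤d)

  private
    lowered : ∀ I S {m} → total S ≤ m → total (map (lower I) S) ≤ m
    lowered I S = ≤-trans (≤-reflexive (total-lower I S))

    length-tick : ∀ I S → length (map (lower I) S) ≡ length (map (lower (suc I)) S)
    length-tick I S = trans (length-map (lower I) S) (sym (length-map (lower (suc I)) S))

    lower-absorbing : ∀ I e S → Absorbing I e S (length (map (lower I) S))
    lower-absorbing I e S =
      (λ _ → ≤-reflexive (sym (length-map (lower I) S))) ,
      λ { {S′ = S′} refl → ≤-trans (n≤1+n _) (≤-reflexive (cong suc (sym (length-map (lower I) S′)))) }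

    lower-slack : ∀ I S → length (map (lower I) S) ≤ 2 + length S
    lower-slack I S = ≤-trans (≤-reflexive (length-map (lower I) S)) (m≤n+m (length S) 2)

    Stables-head : ∀ {D q S} → Stables D (q ∷ S) → D < degree q
    Stables-head (next _ _ D<q _) = D<q

  -- By `reach`, t is at least `total 𝓡` when covered and at least `total 𝓡′` for a twin. So a
  -- frontier in 𝓡, respectively 𝓡′, is the first group there and is taken whole; only the head or
  -- g₂ can split. Splitting a covered head opens a twin, whose g₂ is not counted, and splits within
  -- a twin merge at once. Hence Q never grows.
  frontierSettled▹ : ∀ {t I g R S Q z b} T → Right R S Q z →
    Actives g (total S) T → Stables (degree (top g T) + I) S → length T ≤ 2 →
    Settled g (rest I T S) Q →
    (∀ {m} → m ≤ degree g → m ≤ total (rest I T S) → m ≤ t) →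
    total S < t → t ≤ size (top g T) + total S → t ≤ degree g →
    Spec z (cached g ∷ (map cached T ʳ++ R))
      (connectFrontier n b t (activeRegisters I T S)) (State Whatever (begin g))
  frontierSettled▹ {I = I} {g} {S = S} [] ri act st T≤2 (covered tot refl) reach s<t t≤ t≤d =
    headFrontier▹ ri (lower-slack I S)
      (lower-absorbing I g S)
      act st s<t t≤ t≤d
      (covered (lowered (suc I) S (<⇒≤pred (≤-trans s<t t≤d))) (length-tick I S))
  -- The remainder of a split head keeps `degree g`, to which g₂ drops in the same round, so they
  -- must merge.
  frontierSettled▹ {t} {I} {g} {S = q ∷ S} [] ri act st T≤2 (twin _ _ refl d≡ tot refl) reach s<t t≤ t≤d =
    headFrontier▹ ri (≤-trans (lower-slack I S) (n≤1+n _))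
      ((λ { (next _ _ lt _) → contradiction lt (<-irrefl (trans (+-suc (degree g) I) (sym q≡))) })
        , λ { refl → ≤-reflexive (sym (length-map (lower I) S)) })
      act st s<t t≤ t≤d
      (twin _ _ refl (trans (sym (pred[m∸n]≡m∸[1+n] (degree q) I)) (trans (cong pred d≡) (sym (suc-pred-pos 0<d))))
        (lowered (suc I) S (<⇒≤pred (≤-trans (s≤s (m≤n+m (total S) (size q))) (≤-trans s<t t≤d))))
        (length-tick I S))
    where
    0<d : 0 < degree g
    0<d = ≤-trans (s≤s z≤n) (≤-trans s<t t≤d)
    q≡ : degree q ≡ suc (degree g + I)
    q≡ = trans (sym (m∸n+n≡m I≤q)) (cong (_+ I) d≡)
      where
      I≤q : I ≤ degree q
      I≤q = ≤-trans (m≤n+m I (degree g)) (<⇒≤ (Stables-head st))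
  frontierSettled▹ {S = []} [] ri act st T≤2 (twin _ _ () d≡ tot Q≡) reach s<t t≤ t≤d
  frontierSettled▹ {t} {I} {g} {R} {S} {Q} {z} (e ∷ []) ri (next b 0<e g<e (head bg)) st T≤2
    (covered tot refl) reach s<t t≤ t≤d =
    connectWhole▹ [] (cached g ∷ []) refl a≡ whole
    where
    t≡ : t ≡ size e + total S
    t≡ = ≤-antisym t≤ (≤-trans (≤-reflexive (cong (size e +_) (sym (total-lower I S)))) (reach tot ≤-refl))
    a≡ : t ∸ total S ≡ size e
    a≡ = trans (cong (_∸ total S) t≡) (m+n∸n≡m (size e) (total S))
    0<d : 0 < degree e
    0<d = ≤-trans (s≤s z≤n) g<e
    tot′ : size e + total S ≤ degree g
    tot′ = ≤-trans (≤-reflexive (cong (size e +_) (sym (total-lower I S)))) tot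
    whole : Spec z (cached g ∷ cached (decrement e) ∷ R)
      (mergeLeft 1 (registers (suc I) 2 (length S) (total S))) (State Whatever (begin g))
    whole with degree g ≟ pred (degree e)
    ... | yes g≡ = mergeLeft-merge▹ [] [] refl g≡
      (settled {T = []} refl tt refl (Right-lower (n≤1+n _) ri)
        (head (trans (cong (begin g +_) (+-assoc (size g) _ _)) bg))
        (subst (λ d → Stables (d + suc I) S) (sym g≡) (tick 0<d st)) z≤n
        (covered (lowered (suc I) S (≤-trans (m≤n+m _ (size e)) tot′)) (length-tick I S))
        refl ≤-refl)
    ... | no g≢ = mergeLeft-keep▹ [] [] refl g≢
      (settled {T = decrement e ∷ []} refl tt refl ri
        (next b 0<e (≤∧≢⇒< (<⇒≤pred g<e) g≢) (head bg)) (tick 0<d st) (s≤s z≤n)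
        (covered (≤-trans (≤-reflexive (cong (size e +_) (total-lower (suc I) S))) tot′)
          (cong suc (length-tick I S)))
        refl ≤-refl)
  frontierSettled▹ {t} {I} {g} {R} {S} {Q} {z} (e ∷ []) ri (next b 0<e g<e (head bg)) st T≤2
    (twin _ _ refl d≡ tot refl) reach s<t t≤ t≤d
    with t ∸ total S ≟ size e
  -- The lowered g₂ has the degree of the head and disappears into it, which ends the twin.
  ... | yes a≡ = connectWhole▹ [] (cached g ∷ []) refl a≡ (mergeLeft-merge▹ [] [] refl (sym (cong pred d≡))
      (settled {T = []} refl tt refl ri
        (head (trans (cong (begin g +_) (+-assoc (size g) _ _)) bg))
        (subst (λ d → Stables (d + suc I) S) (cong pred d≡) (tick 0<d st)) z≤n
        (covered (lowered (suc I) S (≤-trans (≤-reflexive (sym (total-lower I S))) tot)) (length-tick I S))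
        refl ≤-refl))
    where
    0<d : 0 < degree e
    0<d = ≤-trans (s≤s z≤n) g<e
  ... | no a≢ = weaken▹ (≤-reflexive (+-identityʳ z))
    (split▹ {u = 0} [] (cached g ∷ []) ri (lower-slack I S)
      (lower-absorbing I e S)
      (s≤s z≤n) refl b st s<t t≤ a≢
      λ {e*} {S*} {R*} {z*} ri* d* b* 0<e* sum st* tot* → weaken▹ (m≤m+n z* 0)
        (mergeLeft-merge▹ [] [] {R = cached e* ∷ R*} refl (sym (cong pred d≡))
          (settled {T = e* ∷ []} refl tt refl ri*
            (next b* 0<e* (≤-trans g<e (≤-reflexive (sym d*)))
              (head (trans (cong (begin g +_) (trans (+-assoc (size g) _ _) (cong (size g +_) sum))) bg)))
            st* (s≤s z≤n)
            (twin _ _ refl (trans d* d≡)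
              (lowered (suc I) S* (≤-trans tot* (≤-trans (≤-reflexive (sym (total-lower I S))) tot)))
              (sym (length-map (lower (suc I)) S*)))
            refl ≤-refl)))
  frontierSettled▹ {t} {I} {S = S} (e ∷ h ∷ []) ri (next b 0<e h<e (next bh 0<h g<h (head bg))) st T≤2
    (covered tot Q≡) reach s<t t≤ t≤d =
    -- All of 𝓡 is requested, including the nodes of h, but a frontier at e would leave them out.
    contradiction (≤-trans (reach tot ≤-refl) t≤)
      (<⇒≱ (≤-trans (≤-reflexive (cong (λ m → suc (size e + m)) (sym (total-lower I S)))) (m≤n+m′ 0<h)))
    where
    m≤n+m′ : ∀ {m n} → 0 < n → suc m ≤ n + m
    m≤n+m′ {m} 0<n = +-monoˡ-≤ m 0<n
  frontierSettled▹ {t} {I} {g} {R} {S} {Q} {z} (e ∷ h ∷ []) ri (next b 0<e h<e (next bh 0<h g<h (head bg))) st T≤2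
    (twin _ _ refl d≡ tot refl) reach s<t t≤ t≤d =
    connectWhole▹ (cached g ∷ []) (cached h ∷ []) refl a≡ whole
    where
    t≡ : t ≡ size e + total S
    t≡ = ≤-antisym t≤ (≤-trans (≤-reflexive (cong (size e +_) (sym (total-lower I S)))) (reach tot (m≤n+m _ (size h))))
    a≡ : t ∸ total S ≡ size e
    a≡ = trans (cong (_∸ total S) t≡) (m+n∸n≡m (size e) (total S))
    0<d : 0 < degree e
    0<d = ≤-trans (s≤s z≤n) h<e
    tot′ : size e + total S ≤ degree g
    tot′ = ≤-trans (≤-reflexive (cong (size e +_) (sym (total-lower I S)))) tot
    whole : Spec z (cached g ∷ cached h ∷ cached (decrement e) ∷ R)
      (mergeLeft 2 (registers (suc I) 3 (length S) (total S))) (State Whatever (begin g))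
    whole with degree h ≟ pred (degree e)
    ... | yes h≡ = mergeLeft-merge▹ (cached g ∷ []) [] refl h≡
      (settled {T = h ⊕ decrement e ∷ []} refl tt refl (Right-lower (n≤1+n _) ri)
        (next (trans (cong (begin h +_) (+-assoc (size h) _ _)) bh) (≤-trans 0<h (m≤m+n _ _)) g<h
          (head (trans (cong (λ m → begin g + (size g + m)) (+-assoc (size h) _ _)) bg)))
        (subst (λ d → Stables (d + suc I) S) (sym h≡) (tick 0<d st)) (s≤s z≤n)
        (twin _ _ refl d≡ (lowered (suc I) S (≤-trans (m≤n+m _ (size e)) tot′)) (length-tick I S))
        refl ≤-refl)
    ... | no h≢ = mergeLeft-keep▹ (cached g ∷ []) [] refl h≢
      (settled {T = decrement e ∷ h ∷ []} refl tt refl ri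
        (next b 0<e (≤∧≢⇒< (<⇒≤pred h<e) h≢) (next bh 0<h g<h (head bg))) (tick 0<d st) T≤2
        (twin _ _ refl d≡ (≤-trans (≤-reflexive (cong (size e +_) (total-lower (suc I) S))) tot′)
          (cong suc (length-tick I S)))
        refl ≤-refl)
  frontierSettled▹ (_ ∷ _ ∷ _ ∷ _) _ _ _ (s≤s (s≤s ())) _ _ _ _ _

  -- Whole rounds

  total-ʳ++ : ∀ es {gs} → total (es ʳ++ gs) ≡ total es + total gs
  total-ʳ++ []            = refl
  total-ʳ++ (e ∷ es) {gs} = trans (total-ʳ++ es) (trans (sym (+-assoc (total es) (size e) (total gs)))
    (cong (_+ total gs) (+-comm (total es) (size e))))

  total-rest : ∀ I T S → total (rest I T S) ≡ total T + total S
  total-rest I T S = trans (total-ʳ++ T) (cong (total T +_) (total-lower I S))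

  length-rest : ∀ I T S → length (rest I T S) ≡ length T + length S
  length-rest I T S = trans (length-ʳ++ T) (cong (length T +_) (length-map (lower I) S))

  -- As fewer than t nodes are stable on entry, `activateUntil` is idle. In this phase a stable
  -- group becomes active again only by merging with the remainder of a split.
  connectDescending▹ : ∀ t {I g L R T xs S Q v z b} → Left L xs v → Right R S Q z → Trail I T S Q →
    Actives g (total S) (T ++ xs) → Stables (degree (top g (T ++ xs)) + I) S →
    total S < t → t ≤ degree g → begin g + t ≤ suc n →
    Spec (v + (z + credit xs)) (cached g ∷ (L ʳ++ (map cached T ʳ++ R)))
      (connect n b t (activeRegisters I (T ++ xs) S)) (State Whatever (begin g))
  connectDescending▹ (suc t) {I} {g} {T = T} {xs} {S} le ri tr act st s<t t≤d cap
    rewrite activateUntil-idle I (suc (length (T ++ xs))) (length S) s<t =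
    bind▹ (stabiliseTrail▹ le ri tr act st s<t cap) λ where
      (inTrail {xs = xs} refl le ri tr act st s<t t≤ refl w≤) →
        weaken▹ w≤ (frontierTrail▹ xs le ri tr act st s<t t≤ t≤d)
      (atHead {S = S} refl ri act st s<t t≤ refl w≤) →
        weaken▹ w≤ (headFrontier▹ ri (m≤n+m _ 2) ((λ _ → ≤-refl) , λ { refl → n≤1+n _ }) act st s<t t≤ t≤d
          (covered (≤-trans (≤-reflexive (total-lower (suc I) S)) (<⇒≤pred (≤-trans s<t t≤d)))
            (sym (length-map (lower (suc I)) S))))

  connectSettled▹ : ∀ t {I g R T S Q z b} → Right R S Q z →
    Actives g (total S) T → Stables (degree (top g T) + I) S → length T ≤ 2 →
    Settled g (rest I T S) Q →
    (∀ {m} → m ≤ degree g → m ≤ total (rest I T S) → m ≤ t) → t ≤ degree g → begin g + t ≤ suc n →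
    Spec z (cached g ∷ (map cached T ʳ++ R))
      (connect n b t (activeRegisters I T S)) (State Whatever (begin g))
  connectSettled▹ zero ri act st T≤2 se reach t≤d cap =
    return▹ (settled refl tt refl ri act st T≤2 se refl ≤-refl)
  connectSettled▹ (suc t) {I} {g} {T = T₀} {S₀} {Q} ri act st T≤2 se reach t≤d cap =
    bind▹ (activateWindow▹ S₀ ri refl act st T≤2 refl (proj₁ (slack se)) (proj₂ (slack se)) far (s≤s z≤n)) λ where
      (window {T} refl ri act st T≤2 rest≡ Q≤ ≤Q refl w≤ s<t) → weaken▹ w≤
        (bind▹ (stabiliseWindow▹ T ri refl act st T≤2 rest≡ Q≤ ≤Q s<t cap) λ where
          (window {T} refl ri act st T≤2 rest≡ Q≤ ≤Q refl w≤ (s<t , t≤)) → weaken▹ w≤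
            (frontierSettled▹ T ri act st T≤2 (subst (λ 𝓡 → Settled g 𝓡 Q) (sym rest≡) se)
              (λ m≤d m≤ → reach m≤d (≤-trans m≤ (≤-reflexive (cong total rest≡)))) s<t t≤ t≤d))
    where
    slack : Settled g (rest I T₀ S₀) Q → Q ≤ length T₀ + length S₀ × length T₀ + length S₀ ≤ suc Q
    slack (covered _ refl) = ≤-reflexive (length-rest I T₀ S₀) ,
      ≤-trans (≤-reflexive (sym (length-rest I T₀ S₀))) (n≤1+n _)
    slack (twin _ _ eq _ _ refl) = ≤-trans (n≤1+n _) (≤-reflexive len) , ≤-reflexive (sym len)
      where
      len = trans (sym (cong length eq)) (length-rest I T₀ S₀)
    -- All of 𝓡, or of 𝓡′ for a twin, is requested, and besides S this includes the nonempty active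
    -- group e.
    far : ∀ T S → length T ≡ 2 → Actives g (total S) T → rest I T S ≡ rest I T₀ S₀ → total S < suc t
    far (e ∷ h ∷ []) S refl (next _ 0<e _ (next _ 0<h _ _)) eq =
      ≤-trans (≤-trans (+-monoˡ-≤ (total S) 0<e) (≤-reflexive (cong (size e +_) (sym (total-lower I S))))) (tail se)
      where
      tail : Settled g (rest I T₀ S₀) Q → size e + total (map (lower I) S) ≤ suc t
      tail (covered tot _) = ≤-trans (≤-trans (m≤n+m _ (size h)) (≤-reflexive (cong total eq))) (reach tot ≤-refl)
      tail (twin g₂ 𝓡′ eq′ _ tot _) with refl , refl ← ∷-injective (trans eq eq′) =
        reach tot (≤-trans (m≤n+m _ (size h)) (≤-reflexive (cong total eq)))

  Actives-extract : ∀ {g m es} → 0 < size g → Actives g m es → Actives (extract g) m es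
  Actives-extract {group b (suc s) d} {m} 0<g (head eq) = head (trans (sym (+-suc b (s + m))) eq)
  Actives-extract {es = _ ∷ []}     0<g (next b 0<e lt act) = next b 0<e lt (Actives-extract 0<g act)
  Actives-extract {es = _ ∷ _ ∷ _}  0<g (next b 0<e lt act) = next b 0<e lt (Actives-extract 0<g act)

  Actives-total : ∀ {g m es} → Actives g m es → begin g + (size g + (total es + m)) ≡ suc n
  Actives-total (head eq) = eq
  Actives-total {g} {m} {e ∷ es} (next _ _ _ act) =
    trans (cong (λ x → begin g + (size g + x)) (arith (size e) (total es) m)) (Actives-total act)
    where
    arith : ∀ x y z → x + y + z ≡ y + (x + z)
    arith x y z = solve (x ∷ y ∷ z ∷ [])

  remaining : ∀ {g m es} → 0 < size g → Actives g m es → n ∸ begin g ≡ pred (size g) + (total es + m)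
  remaining {group b (suc s) d} {m} {es} _ act =
    trans (cong (_∸ b) (suc-injective (sym (trans (sym (+-suc b _)) (Actives-total act))))) (m+n∸m≡n b _)

  capacity : ∀ {g t m es} → 0 < size g → Actives g m es → t ≤ n ∸ begin g → suc (begin g) + t ≤ suc n
  capacity {g} {t} {m} {es} 0<g act t≤ = s≤s (≤-trans (+-monoʳ-≤ (begin g) t≤) (≤-reflexive (m+[n∸m]≡n b≤n)))
    where
    b≤n : begin g ≤ n
    b≤n = s≤s⁻¹ (≤-trans (≤-trans (≤-reflexive (+-comm 1 (begin g)))
      (+-monoʳ-≤ (begin g) (≤-trans 0<g (m≤m+n _ _)))) (≤-reflexive (Actives-total act)))

  -- k rounds are left; dormant is the case of a head that is still stable.
  data Next (k : ℕ) (σ : Store) (ρ : Registers) (w : ℕ) : Set where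
    live      : ∀ b → b + k ≡ suc n → State (0 <_) b σ ρ w → Next k σ ρ w
    dormant   : ∀ {I d q S z} → begin q + k ≡ suc n → Right σ (q ∷ S) (length S) z →
                Stables (d + I) (q ∷ S) → total S ≤ d →
                ρ ≡ registers I 0 (suc (length S)) (total (q ∷ S)) → z ≤ w → Next k σ ρ w
    exhausted : k ≡ 0 → Next k σ ρ w

  -- An empty head owns no ids, so the group after it starts at the same id and can take its place.
  Actives-∷ʳ : ∀ {g m x} es → size g ≡ 0 → Actives g m (es ∷ʳ x) →
    begin x ≡ begin g × 0 < size x × degree g < degree x × Actives x m es
  Actives-∷ʳ {g} {m} {x} [] s≡0 (next b 0<x lt (head b′)) =
    +-cancelʳ-≡ (size x + m) (begin x) (begin g)
      (trans b (trans (sym b′) (cong (λ s → begin g + (s + (size x + m))) s≡0))) , 0<x , lt , head b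
  Actives-∷ʳ (e ∷ [])     s≡0 (next b 0<e lt act) with b≡ , 0<x , lt′ , act′ ← Actives-∷ʳ [] s≡0 act =
    b≡ , 0<x , lt′ , next b 0<e lt act′
  Actives-∷ʳ (e ∷ e′ ∷ es) s≡0 (next b 0<e lt act) with b≡ , 0<x , lt′ , act′ ← Actives-∷ʳ (e′ ∷ es) s≡0 act =
    b≡ , 0<x , lt′ , next b 0<e lt act′

  -- The next head has a larger degree, so `total S` stays below the minimal degree. If only the
  -- trail is left, a left pair supplies both a head and a frontier; a single group becomes the
  -- head, and with everything behind it stable the list is `covered`.
  promote▹ : ∀ {I g L R T S Q v z b k} xs → b + k ≡ suc n → begin g ≡ b → size g ≡ 0 →
    Left L xs v → Right R S Q z → Trail I T S Q →
    Actives g (total S) (T ++ xs) → Stables (degree (top g (T ++ xs)) + I) S → total S < degree g →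
    Spec (v + (z + credit xs)) (L ʳ++ (map cached T ʳ++ R))
      (return (registers I (length (T ++ xs)) (length S) (total S))) (Next k)
  promote▹ {I} {g} {L} {R} {T} {S} {Q} {v} {z} xs bk b≡ s≡0 le ri tr act st s<d with initLast xs
  ... | xs′ ∷ʳ′ x = weaken▹ (+-monoʳ-≤ v (+-monoʳ-≤ z (+-monoʳ-≤ 4 (*-monoʳ-≤ 4 len≤))))
    (exposeBack▹ {u = z + credit xs′} (map cached T ʳ++ R) le fit λ {L′} {v′} le′ →
      return▹ (promoted tr act st le′))
    where
    len≤ : length xs′ ≤ length (xs′ ∷ʳ x)
    len≤ = ≤-trans (n≤1+n _) (≤-reflexive (sym (length-∷ʳ x xs′)))
    T≤2 : ∀ {T} → Trail I T S Q → length T ≤ 2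
    T≤2 lone          = s≤s z≤n
    T≤2 (rightPair _) = s≤s z≤n
    T≤2 (leftPair _)  = ≤-refl
    fit : B + B + cachedItems (map cached T ʳ++ R) ≤ M
    fit = ≤-trans (+-monoʳ-≤ (B + B) (≤-trans (≤-reflexive (cachedItems-ʳ++ (map cached T) R))
        (+-mono-≤ (≤-trans (≤-reflexive (cachedItems-cached T)) (T≤2 tr)) (Right-cached ri))))
      (≤-trans (≤-reflexive (+-comm (B + B) _))
        (≤-trans (≤-reflexive (cong (2 +_) (+-comm (B + B + 4) (B + B)))) (room 2 (s≤s (s≤s z≤n)) ≤-refl ≤-refl)))
    promoted : ∀ {T L′ v′} → Trail I T S Q → Actives g (total S) (T ++ (xs′ ∷ʳ x)) →
      Stables (degree (top g (T ++ (xs′ ∷ʳ x))) + I) S → Left L′ xs′ v′ →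
      Next _ (cached x ∷ (L′ ʳ++ (map cached T ʳ++ R)))
        (registers I (length (T ++ (xs′ ∷ʳ x))) (length S) (total S)) (v′ + (z + credit xs′))
    promoted {T = e ∷ T} tr act st le′
      with b′ , 0<x , lt , act′ ← Actives-∷ʳ (e ∷ T ++ xs′) s≡0
             (subst (Actives g (total S)) (sym (++-assoc (e ∷ T) xs′ (x ∷ []))) act) =
      live _ bk (descending (trans b′ b≡) 0<x refl le′ ri tr act′ st (<-trans s<d lt)
        (cong (λ f → registers I f (length S) (total S))
          (trans (cong length (sym (++-assoc (e ∷ T) xs′ (x ∷ [])))) (length-∷ʳ x (e ∷ T ++ xs′)))) ≤-refl)
  promote▹ {I} {g} {v = v} {z} .[] bk b≡ s≡0 le ri (leftPair {e} {h} gap) act st s<d | []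
    rewrite Left-[] le with b′ , 0<h , lt , act′ ← Actives-∷ʳ (e ∷ []) s≡0 act =
    return▹ (live _ bk (descending {T = e ∷ []} (trans b′ b≡) 0<h refl
      Left-empty ri lone act′ st (<-trans s<d lt) refl (m≤n+m _ v)))
  promote▹ {I} {g} {S = S} {v = v} {z} .[] bk b≡ s≡0 le ri (lone {e}) act st s<d | []
    rewrite Left-[] le with b′ , 0<e , lt , act′ ← Actives-∷ʳ [] s≡0 act =
    return▹ (live _ bk (settled {T = []} (trans b′ b≡) 0<e refl ri act′ st z≤n
      (covered (≤-trans (≤-reflexive (total-lower I S)) (<⇒≤ (<-trans s<d lt))) (sym (length-map (lower I) S)))
      refl (≤-trans (m≤m+n z 4) (m≤n+m _ v))))
  promote▹ {I} {g} {S = q ∷ S} {v = v} {z} .[] bk b≡ s≡0 le ri (rightPair {e} gap) act st s<d | []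
    rewrite Left-[] le with b′ , 0<e , lt , act′ ← Actives-∷ʳ [] s≡0 act =
    return▹ (live _ bk (settled {T = []} (trans b′ b≡) 0<e refl
      (Right-raise {Q′ = suc (length S)} 2 (≤-trans (n≤1+n _) (≤-reflexive (+-comm 2 (length S)))) ri) act′ st z≤n
      (covered (≤-trans (≤-reflexive (total-lower I (q ∷ S))) (<⇒≤ (<-trans s<d lt))) (sym (length-map (lower I) (q ∷ S))))
      refl (m≤n+m _ v)))

  -- Dropping the first group behind g turns either settled case into `covered`: what remains has at
  -- most `degree g` nodes, and the new head has a larger degree. The new head may itself still be
  -- stable, hence `dormant`.
  uncover▹ : ∀ {I g R S Q z b k} T → b + k ≡ suc n → begin g ≡ b → size g ≡ 0 → Right R S Q z →
    Actives g (total S) T → Stables (degree (top g T) + I) S → length T ≤ 2 → Settled g (rest I T S) Q →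
    Spec z (map cached T ʳ++ R) (return (registers I (length T) (length S) (total S))) (Next k)
  uncover▹ {I} {g} {S = S} {Q} T bk b≡ s≡0 ri act st T≤2 se = return▹ (uncovered T act st T≤2 se)
    where
    tail : ∀ {𝓡 x xs} → 𝓡 ≡ x ∷ xs → Settled g 𝓡 Q → total xs ≤ degree g × length xs ≤ Q
    tail {x = x} refl (covered tot refl) = ≤-trans (m≤n+m _ (size x)) tot , n≤1+n _
    tail refl (twin _ _ refl _ tot refl) = tot , ≤-refl
    uncovered : ∀ T → Actives g (total S) T → Stables (degree (top g T) + I) S → length T ≤ 2 →
      Settled g (rest I T S) Q →
      Next _ (map cached T ʳ++ _) (registers I (length T) (length S) (total S)) _
    uncovered [] act st T≤2 se = bare S refl
      where
      bare : ∀ S′ → S ≡ S′ → Next _ _ (registers I 0 (length S) (total S)) _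
      bare [] refl = exhausted (+-cancelˡ-≡ (begin g) _ 0 (trans (cong (_+ _) b≡) (trans bk
        (trans (sym (Actives-total act)) (cong (λ s → begin g + (s + 0)) s≡0)))))
      bare (q ∷ S′) refl = dormant (trans (cong (_+ _) (trans q≡ b≡)) bk)
        (Right-lower (≤-trans (≤-reflexive (sym (length-map (lower I) S′))) (proj₂ (tail refl se))) ri) st
        (≤-trans (≤-reflexive (sym (total-lower I S′))) (proj₁ (tail refl se))) refl ≤-refl
        where
        stored : ∀ {D} → Stables D (q ∷ S′) → begin q + (size q + total S′) ≡ suc n
        stored (next b _ _ _) = b
        q≡ : begin q ≡ begin g
        q≡ = +-cancelʳ-≡ (size q + total S′) (begin q) (begin g)
          (trans (stored st) (trans (sym (Actives-total act)) (cong (λ s → begin g + (s + (size q + total S′))) s≡0)))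
    uncovered (e ∷ []) act st T≤2 se with b′ , 0<e , lt , act′ ← Actives-∷ʳ [] s≡0 act =
      live _ bk (settled {T = []} (trans b′ b≡) 0<e refl
        (Right-lower (proj₂ (tail refl se)) ri) act′ st z≤n
        (covered (≤-trans (proj₁ (tail refl se)) (<⇒≤ lt)) refl) refl ≤-refl)
    uncovered (e ∷ h ∷ []) act st T≤2 se with b′ , 0<h , lt , act′ ← Actives-∷ʳ (e ∷ []) s≡0 act =
      live _ bk (settled {T = e ∷ []} (trans b′ b≡) 0<h refl
        (Right-lower (proj₂ (tail refl se)) ri) act′ st (s≤s z≤n)
        (covered (≤-trans (proj₁ (tail refl se)) (<⇒≤ lt)) refl) refl ≤-refl)
    uncovered (_ ∷ _ ∷ _ ∷ _) act st (s≤s (s≤s ())) se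

  removeEmptyHead▹ : ∀ {b k σ ρ w} → b + k ≡ suc n → State Whatever b σ ρ w →
    Spec w σ (removeEmptyHead ρ) (Next k)
  removeEmptyHead▹ bk (descending {g = g} {xs = xs} b≡ _ refl le ri tr act st s<d refl w≤) with size g ≟ 0
  ... | yes s≡0 = read▹ [] [] refl (ifTrue▹ (≡ᵇ-true s≡0) (delete▹ [] [] refl
    (weaken▹ w≤ (promote▹ xs bk b≡ s≡0 le ri tr act st s<d))))
  ... | no s≢0 = read▹ [] [] refl (ifFalse▹ (≡ᵇ-false s≢0)
    (return▹ (live _ bk (descending b≡ (n≢0⇒n>0 s≢0) refl le ri tr act st s<d refl w≤))))
  removeEmptyHead▹ bk (settled {g = g} {T} b≡ _ refl ri act st T≤2 se refl w≤) with size g ≟ 0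
  ... | yes s≡0 = read▹ [] [] refl (ifTrue▹ (≡ᵇ-true s≡0) (delete▹ [] [] refl
    (weaken▹ w≤ (uncover▹ T bk b≡ s≡0 ri act st T≤2 se))))
  ... | no s≢0 = read▹ [] [] refl (ifFalse▹ (≡ᵇ-false s≢0)
    (return▹ (live _ bk (settled b≡ (n≢0⇒n>0 s≢0) refl ri act st T≤2 se refl w≤))))

  top-extract : ∀ g es → degree (top (extract g) es) ≡ degree (top g es)
  top-extract g []      = refl
  top-extract g (_ ∷ _) = refl

  extractHead : Registers → Prog Registers
  extractHead ρ = read 0 λ g → write 0 (extract g)
    (connect n (begin g) (degree g ⊓ (n ∸ begin g)) ρ >>= removeEmptyHead)

  extractHead▹ : ∀ {b k σ ρ w} → b + suc k ≡ suc n → State (0 <_) b σ ρ w →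
    Spec w σ (extractHead ρ) (Next k)
  extractHead▹ {k = k} bk (descending {I} {g} {T} {xs} {S = S} refl 0<g refl le ri tr act st s<d refl w≤) =
    read▹ [] [] refl (write▹ [] [] refl
      (bind▹ (weaken▹ w≤ (connectDescending▹ _ le ri tr (Actives-extract 0<g act)
                (subst (λ d → Stables (d + I) S) (sym (top-extract g (T ++ xs))) st)
                -- Capping by the remaining nodes is harmless: the frontier group lies beyond the
                -- head, is nonempty and is not stable, so more than `total S` nodes remain.
                (⊓-glb s<d (≤-trans (behind tr act) (≤-reflexive (sym (remaining 0<g act)))))
                (m⊓n≤m _ _) (capacity 0<g act (m⊓n≤n (degree g) _))))
             (removeEmptyHead▹ (trans (sym (+-suc (begin g) k)) bk))))
    where
    behind : ∀ {T Q} → Trail I T S Q → Actives g (total S) (T ++ xs) →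
             total S < pred (size g) + (total (T ++ xs) + total S)
    behind {T = e ∷ T} tr (next _ 0<e _ _) =
      ≤-trans (+-monoˡ-≤ (total S) (≤-trans 0<e (m≤m+n (size e) _))) (m≤n+m _ (pred (size g)))
  extractHead▹ {k = k} bk (settled {I} {g} {T} {S = S} refl 0<g refl ri act st T≤2 se refl w≤) =
    read▹ [] [] refl (write▹ [] [] refl
      (bind▹ (weaken▹ w≤ (connectSettled▹ _ ri (Actives-extract 0<g act)
                (subst (λ d → Stables (d + I) S) (sym (top-extract g T)) st) T≤2 (unextracted se)
                -- All of 𝓡 remains after the extraction, so the cap on t never falls below
                -- `total 𝓡`.
                (λ m≤d m≤ → ⊓-glb m≤d (≤-trans m≤ (≤-trans (≤-reflexive (total-rest I T S))
                  (≤-trans (m≤n+m _ (pred (size g))) (≤-reflexive (sym (remaining 0<g act)))))))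
                (m⊓n≤m _ _) (capacity 0<g act (m⊓n≤n (degree g) _))))
             (removeEmptyHead▹ (trans (sym (+-suc (begin g) k)) bk))))
    where
    unextracted : ∀ {𝓡 Q} → Settled g 𝓡 Q → Settled (extract g) 𝓡 Q
    unextracted (covered tot Q≡)          = covered tot Q≡
    unextracted (twin g₂ 𝓡′ eq d≡ tot Q≡) = twin g₂ 𝓡′ eq d≡ tot Q≡

  round▹ : ∀ {k σ ρ w} → Next (suc k) σ ρ w → Spec w σ (round n ρ) (Next k)
  round▹ (live b bk st@(descending _ _ _ _ _ _ _ _ _ refl _)) = extractHead▹ bk st
  round▹ (live b bk st@(settled _ _ _ _ _ _ _ _ refl _))      = extractHead▹ bk st
  round▹ {ρ = ρ} (dormant {I} {d} {q} {S} {z} bk ri (next b 0<q d<q st) tot refl w≤) =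
    bind▹ {p = activateHead ρ} {f = extractHead} (weaken▹ (≤-trans (≤-reflexive (+-identityʳ z)) w≤)
      (exposeRight▹ {u = 0} [] [] ri (m≤n+m _ 3) fit λ {_} {z′} ri′ _ →
        read▹ [] [] refl (write▹ [] [] refl (return▹
          (settled {T = []} refl 0<q refl ri′ (head b)
            (lower-Stables {D = d} d<q st) z≤n
            -- The recovered degree of q is at least d, which bounds `total S`.
            (covered (≤-trans (≤-reflexive (total-lower I S))
                (≤-trans tot (m+n≤o⇒m≤o∸n d (<⇒≤ d<q))))
              (sym (length-map (lower I) S)))
            (cong (registers I 1 (length S)) (m+n∸m≡n (size q) (total S))) (m≤m+n z′ 0))))))
      (extractHead▹ bk)
    where
    fit : 0 + (0 + B) ≤ M
    fit = room 0 z≤n z≤n (≤-trans (m≤m+n B B) (m≤m+n (B + B) 4))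

  rounds▹ : ∀ k {σ ρ w} → Next k σ ρ w → Spec w σ (rounds n k ρ) (λ _ _ _ → ⊤)
  rounds▹ zero    _    = return▹ tt
  rounds▹ (suc k) at = bind▹ (round▹ at) (rounds▹ k)

  -- The initial list and its potential

  prependNode-Stables : ∀ {D} i d gs → i + suc (total gs) ≡ suc n → D < d → Stables (pred d) gs →
                        Stables D (prependNode i d gs)
  prependNode-Stables i d []       b D<d st = next b (s≤s z≤n) D<d none
  -- The bound d still admits a first group of degree `suc d`, which then absorbs the node.
  prependNode-Stables i (suc d) (g ∷ gs) b D<d (next bg 0<g d<g st) with suc d ≟ degree g
  ... | yes d≡ rewrite ≡ᵇ-true d≡  = next b (s≤s z≤n) D<d (subst (λ d → Stables d gs) (sym d≡) st)
  ... | no d≢  rewrite ≡ᵇ-false d≢ = next b (s≤s z≤n) D<d (next bg 0<g (≤∧≢⇒< d<g d≢) st)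

  groupsFrom-Stables : ∀ {D} i ds → i + length ds ≡ suc n → All (D <_) ds → Linked _≤_ ds →
                       Stables D (groupsFrom i ds)
  groupsFrom-Stables i []           b _ _ = none
  groupsFrom-Stables i (d ∷ [])     b (D<d All.∷ _) _ = prependNode-Stables i d [] b D<d none
  groupsFrom-Stables i (d ∷ d′ ∷ ds) b (D<d All.∷ D<ds) (d≤d′ Linked.∷ sorted) =
    prependNode-Stables i d _ (trans (cong (λ m → i + suc m) (total-groupsFrom (suc i) (d′ ∷ ds))) b) D<d
      (groupsFrom-Stables (suc i) (d′ ∷ ds) (trans (sym (+-suc i _)) b)
        (All.map (≤-trans (≤-trans (≤-reflexive (suc-pred-pos (≤-trans (s≤s z≤n) D<d))) d≤d′))
          (Linked⇒All ≤-trans ≤-refl sorted)) sorted)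

  -- At iteration 0 stored and actual degrees agree, so the order established for `Stables` carries
  -- over to a list that is entirely active.
  activate-all : ∀ {g} S {es} → Actives g (total S) es → Stables (degree (top g es)) S → Actives g 0 (S ʳ++ es)
  activate-all []      act none                = act
  activate-all (q ∷ S) act (next b 0<q d<q st) = activate-all S (next b 0<q d<q act) st

  Block : List Group → Set
  Block blk = 0 < length blk × length blk ≤ B

  data Packed : List Group → Set where
    nothing : Packed []
    blocks  : ∀ {gs} b bs → packed B gs ≡ map onDisk (b ∷ bs) → concat (b ∷ bs) ≡ gs → All Block (b ∷ bs) →
              length b + B * length bs ≡ length gs → Packed gs

  packed-view : ∀ gs → Packed gs
  packed-view []       = nothing
  packed-view (g ∷ gs) with packed-view gs
  ... | nothing = blocks (g ∷ []) [] refl refl ((s≤s z≤n , 0<B) All.∷ All.[]) (cong suc (*-zeroʳ B))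
  ... | blocks b bs eq concat≡ ((0<b , b≤B) All.∷ ok) len with length b <? B
  ...   | yes b<B = blocks (g ∷ b) bs (trans (cong (consPacked B g) eq) step) (cong (g ∷_) concat≡)
                      ((s≤s z≤n , b<B) All.∷ ok) (cong suc len)
    where
    step : consPacked B g (map onDisk (b ∷ bs)) ≡ map onDisk ((g ∷ b) ∷ bs)
    step rewrite <ᵇ-true b<B = refl
  ...   | no b≮B = blocks (g ∷ []) (b ∷ bs) (trans (cong (consPacked B g) eq) step) (cong (g ∷_) concat≡)
                     ((s≤s z≤n , 0<B) All.∷ (0<b , b≤B) All.∷ ok)
                     (cong suc (trans (*-suc B (length bs)) (trans (cong (_+ B * length bs)
                       (≤-antisym (≮⇒≥ b≮B) b≤B)) len)))
    where
    step : consPacked B g (map onDisk (b ∷ bs)) ≡ map onDisk ((g ∷ []) ∷ b ∷ bs)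
    step rewrite <ᵇ-false (≮⇒≥ b≮B) = refl

  initialLeft : ∀ bs → All Block bs → Left (map onDisk bs ʳ++ []) (concat bs ʳ++ []) (B * length bs)
  initialLeft bs ok = left [] [] (map reverse bs ʳ++ []) (trans (itemCount≡ bs) (sym (++-identityʳ _)))
    (trans (items≡ bs []) (sym (++-identityʳ _))) z≤n z≤n (sizes≡ bs ok All.[])
    (cong (B *_) (trans (sym (length-map reverse bs)) (trans (sym (+-identityʳ _)) (sym (length-ʳ++ (map reverse bs))))))
    where
    itemCount≡ : ∀ bs → map onDisk bs ʳ++ [] ≡ map ʳBlock (map reverse bs ʳ++ [])
    itemCount≡ bs = sym (trans (map-ʳ++ ʳBlock (map reverse bs)) (cong (_ʳ++ [])
      (trans (sym (map-∘ bs)) (map-cong (λ b → cong onDisk (reverse-involutive b)) bs))))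
    items≡ : ∀ bs Ls → concat bs ʳ++ concat Ls ≡ concat (map reverse bs ʳ++ Ls)
    items≡ []       Ls = refl
    items≡ (b ∷ bs) Ls = trans (++-ʳ++ b) (trans (cong (concat bs ʳ++_) (ʳ++-defn b)) (items≡ bs (reverse b ∷ Ls)))
    sizes≡ : ∀ bs {Ls} → All Block bs → All Block Ls → All Block (map reverse bs ʳ++ Ls)
    sizes≡ []       All.[]         oks = oks
    sizes≡ (b ∷ bs) (o All.∷ ok) oks =
      sizes≡ bs ok (subst (λ l → 0 < l × l ≤ B) (sym (length-reverse b)) o All.∷ oks)

  start▹ : ∀ g S {L v} → Left L (reverse S) v → Actives g 0 (reverse S) → 0 < degree g → 0 < size g →
    begin g + n ≡ suc n →
    Spec (v + (4 + 4 * length S)) (cached g ∷ (L ʳ++ []))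
      (rounds n n (registers 0 (suc (length S)) 0 0)) (λ _ _ _ → ⊤)
  start▹ g S {L} {v} le act 0<d 0<g bn =
    subst (λ l → Spec (v + (4 + 4 * l)) (cached g ∷ (L ʳ++ []))
        (rounds n n (registers 0 (suc l) 0 0)) (λ _ _ _ → ⊤))
      (length-reverse S) (go (reverse S) le act)
    where
    ri : Right [] [] 0 0
    ri = right [] [] 0 refl refl z≤n All.[] z≤n (sym (trans (+-identityʳ _) (*-zeroʳ B)))
    go : ∀ es {L v} → Left L es v → Actives g 0 es →
      Spec (v + (4 + 4 * length es)) (cached g ∷ (L ʳ++ []))
        (rounds n n (registers 0 (suc (length es)) 0 0)) (λ _ _ _ → ⊤)
    go [] le act rewrite Left-[] le =
      rounds▹ n (live _ bn (settled {T = []} refl 0<g refl ri act none z≤n (covered z≤n refl) refl z≤n))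
    go (e ∷ xs) le act = exposeFront▹ (cached g ∷ []) [] le (room 1 (s≤s z≤n) ≤-refl z≤n) λ {L′} {v′} le′ _ →
      rounds▹ n (live _ bn (descending {T = e ∷ []} refl 0<g refl le′ ri lone act none 0<d refl
        (+-monoʳ-≤ v′ (+-monoʳ-≤ 4 (*-monoʳ-≤ 4 (n≤1+n (length xs)))))))

  -- Blocks are filled from the end of the list, so only the first can be short and
  -- `B + length (g ∷ S)` pays for loading each block once. The other summand is `credit`: four
  -- units per group behind the head and the first four.
  em-hh▹ : ∀ g S ds → groups ds ≡ g ∷ S → n ≡ length ds → All (0 <_) ds → Linked _≤_ ds →
    Spec (B + length (g ∷ S) + 4 * length (g ∷ S)) (packed B (g ∷ S))
      (rounds n n (registers 0 (length (g ∷ S)) 0 0)) (λ _ _ _ → ⊤)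
  em-hh▹ g S ds eq refl positive sorted
    with packed-view (g ∷ S) | subst (Stables 0) eq (groupsFrom-Stables 1 ds refl positive sorted)
  ... | blocks b bs σ≡ concat≡ (block All.∷ ok) len | next b≡ 0<g 0<d st rewrite σ≡ =
    weaken▹ (+-mono-≤ blocks≤ (≤-reflexive (sym (*-suc 4 (length S)))))
      (subst (λ σ → Spec (B * suc (length bs) + (4 + 4 * length S)) σ
          (rounds n n (registers 0 (suc (length S)) 0 0)) (λ _ _ _ → ⊤))
        (trans (ʳ++-ʳ++ (map onDisk (b ∷ bs))) (++-identityʳ _))
        -- At first even the head belongs to the left part; taking it from the back loads its block.
        (exposeBack▹ [] initial (room 0 z≤n ≤-refl z≤n) λ le →
          start▹ g S le (activate-all S (head b≡) st) 0<d 0<g (trans (cong (begin g +_) nodes) b≡)))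
    where
    initial : Left (map onDisk (b ∷ bs) ʳ++ []) (reverse S ∷ʳ g) (B * suc (length bs))
    initial = subst (λ xs → Left (map onDisk (b ∷ bs) ʳ++ []) xs (B * suc (length bs)))
      (trans (cong (_ʳ++ []) concat≡) (ʳ++-defn S)) (initialLeft (b ∷ bs) (block All.∷ ok))
    nodes : length ds ≡ size g + total S
    nodes = trans (sym (total-groupsFrom 1 ds)) (cong total eq)
    blocks≤ : B * suc (length bs) ≤ B + length (g ∷ S)
    blocks≤ = ≤-trans (≤-reflexive (*-suc B (length bs)))
      (+-monoʳ-≤ B (≤-trans (m≤n+m _ (length b)) (≤-reflexive len)))

-- From credit to I/Os

scan-bound : ∀ B k .{{_ : NonZero B}} → k ≤ B * scan B k
scan-bound (suc B) k = +-cancelˡ-≤ B k _ (≤-trans (≤-reflexive B+k≡) (+-mono-≤ (s≤s⁻¹ (m%n<n m (suc B)))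
  (≤-reflexive (*-comm (scan (suc B) k) (suc B)))))
  where
  m = pred (k + suc B)
  B+k≡ : B + k ≡ m % suc B + scan (suc B) k * suc B
  B+k≡ = trans (trans (+-comm B k) (sym (cong pred (+-suc k B)))) (m≡m%n+[m/n]*n m (suc B))

block-bound : ∀ B k .{{_ : NonZero B}} → 0 < k → B ≤ B * scan B k
block-bound B k 0<k with scan B k | scan-bound B k
... | zero  | k≤0 = contradiction (≤-trans 0<k (≤-trans k≤0 (≤-reflexive (*-zeroʳ B)))) λ ()
... | suc s | _   = m≤m*n B (suc s)

-- A nonempty list has a positive `scan`, so B is at most one multiple of `B * scan B D`, and 5G is
-- at most five.
cost-bound : ∀ B .{{_ : NonZero B}} {k w G D} → 0 < G → G ≤ D → B * k + w ≤ B + G + 4 * G → k ≤ 6 * scan B D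
cost-bound B {k} {w} {G} {D} 0<G G≤D cost = *-cancelˡ-≤ B
  (lin w (+-mono-≤ cost (+-mono-≤ (block-bound B D (≤-trans 0<G G≤D)) (*-monoʳ-≤ 5 (≤-trans G≤D (scan-bound B D)))))
    (arith (scan B D)))
  where
  arith : ∀ s → B + G + 4 * G + (B * s + 5 * (B * s)) + B * k + w ≡ B * k + w + (B + 5 * G) + B * (6 * s)
  arith s = solve (B ∷ G ∷ k ∷ w ∷ s ∷ [])

-- The buffers take 2B on the active and 2B + 4 on the stable side; eight more slots serve the head,
-- the trail and groups being split off. Since B is positive, 4B + 12 is at most 16B.
room-for-buffers : ∀ B .{{_ : NonZero B}} {M} → 16 * B ≤ M → 8 + (B + B + (B + B + 4)) ≤ M
room-for-buffers B = ≤-trans (lin 0 (*-monoʳ-≤ 12 (>-nonZero⁻¹ B)) (arith B))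
  where
  arith : ∀ B → 12 * B + (8 + (B + B + (B + B + 4))) + 0 ≡ 12 * 1 + 16 * B
  arith B = solve (B ∷ [])

Affordable : (B M : ℕ) .{{_ : NonZero B}} → List ℕ → Set
Affordable B M 𝒟 = Σ[ k ∈ ℕ ] Σ[ τ ∈ Store ]
  (Run B M (packed B (groups 𝒟)) (em-hh 𝒟) k τ tt × k ≤ 6 * scan B (distinctDegrees 𝒟))

em-hh-affordable : (B M : ℕ) .{{_ : NonZero B}} → 16 * B ≤ M →
  (𝒟 : List ℕ) → All (0 <_) 𝒟 → Linked _≤_ 𝒟 → Affordable B M 𝒟
em-hh-affordable B M room 𝒟 positive sorted = from (groups 𝒟) refl
  where
  run : List Group → ℕ → ℕ → Store → Set
  run gs m k τ = Run B M (packed B gs) (rounds m m (registers 0 (length gs) 0 0)) k τ tt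
  from : ∀ gs → groups 𝒟 ≡ gs → Affordable B M 𝒟
  from [] eq = 0 , packed B (groups 𝒟) ,
    subst (λ m → run (groups 𝒟) m 0 (packed B (groups 𝒟)))
      (trans (sym (cong total eq)) (total-groupsFrom 1 𝒟)) done , z≤n
  from (g ∷ S) eq = conclude
    (EM-HH.em-hh▹ B M (length 𝒟) (>-nonZero⁻¹ B) (room-for-buffers B room) g S 𝒟 eq refl positive sorted)
    where
    conclude : Triples.Spec B M (B + length (g ∷ S) + 4 * length (g ∷ S)) (packed B (g ∷ S))
      (rounds (length 𝒟) (length 𝒟) (registers 0 (length (g ∷ S)) 0 0)) (λ _ _ _ → ⊤) → Affordable B M 𝒟
    conclude (k , τ , _ , w , r , cost , _) =
      k , τ , subst (λ gs → run gs (length 𝒟) k τ) (sym eq) r ,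
      cost-bound B {G = length (g ∷ S)} (s≤s z≤n)
        (≤-trans (≤-reflexive (cong length (sym eq))) (length-groupsFrom 1 𝒟 sorted)) cost

lemma2 : Σ[ c ∈ ℕ ] Σ[ K ∈ ℕ ]
    ((B M : ℕ) .{{_ : NonZero B}} → K * B ≤ M →
    (𝒟 : List ℕ) → All (0 <_) 𝒟 → Linked _≤_ 𝒟 →
    Σ[ k ∈ ℕ ] Σ[ τ ∈ Store ]
    (Run B M (packed B (groups 𝒟)) (em-hh 𝒟) k τ tt × k ≤ c * scan B (distinctDegrees 𝒟)))
lemma2 = 6 , 16 , em-hh-affordable
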